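{- For every integer $k\ge 1$, the set $\mathrm{RedVHC}_k(\mathrm{Av}_{3k}(312))$ of reduced valid hook configurations with exactly $k$ hooks on $312$-avoiding permutations of length $3k$ is in bijection with the set $\mathrm{Dyck}^3_k$ of 3D-Dyck words of length $3k$.
   Context: $S_n$ is the set of permutations $\pi=\pi_1\cdots\pi_n$ of $\{1,\dots,n\}$. $\pi$ is $312$-avoiding if there are no indices $a<b<c$ with $\pi_b<\pi_c<\pi_a$; $\mathrm{Av}_n(312)\subseteq S_n$ is the set of $312$-avoiding permutations of length $n$. The plot of $\pi$ is the set of points $(i,\pi_i)$, $1\le i\le n$. If $\pi_i>\pi_{i+1}$, then $i$ is a descent, $(i,\pi_i)$ is a descent top and $(i+1,\pi_{i+1})$ is a descent bottom. A hook on $\pi$ from $(i,\pi_i)$ to $(j,\pi_j)$, where $i<j$ and $\pi_i<\pi_j$, consists of the vertical segment from $(i,\pi_i)$ up to $(i,\pi_j)$ followed by the horizontal segment from $(i,\pi_j)$ to $(j,\pi_j)$. The point $(i,\pi_i)$ is its southwest (SW) endpoint and $(j,\pi_j)$ its northeast (NE) endpoint. A valid hook configuration on $\pi$ is a set of hooks on $\pi$ such that: (i) the set of SW endpoints of the hooks is exactly the set of descent tops of $\pi$; (ii) no point of the plot lies directly above a hook (for a hook from $(i,\pi_i)$ to $(j,\pi_j)$ there is no $l$ with $i<l<j$ and $\pi_l>\pi_j$); (iii) distinct hooks do not intersect, except at endpoints (the NE endpoint of one hook may be the SW endpoint of another; two hooks sharing the same NE endpoint, or the same SW endpoint, overlap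 in a segment and are not allowed). It is reduced if every point of the plot is a hook endpoint or a descent bottom (or both). For a set $S$ of permutations, $\mathrm{RedVHC}_k(S)$ is the set of all reduced valid hook configurations with exactly $k$ hooks on permutations in $S$ (a configuration includes the data of its underlying permutation). A 3D-Dyck word of length $3k$ is a word with $k$ letters X, $k$ letters Y and $k$ letters Z such that in every prefix the number of X's is at least the number of Y's, which is at least the number of Z's. $\mathrm{Dyck}^3_k$ is the set of these words. -}

module Defs where

open import Level using (0ℓ)
open import Data.Nat.Base using (ℕ; suc; _≤_; _*_)
open import Data.Integer.Base using (+_)
open import Data.Rational.Base as ℚ using (ℚ)
open import Data.Rational.Literals using (fromℤ)
open import Data.Fin.Base using (Fin; toℕ; _<_)
open import Data.Fin.Permutation using (Permutation′; _⟨$⟩ʳ_; _≈_)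
open import Data.Fin.Subset using (Subset; ∣_∣) renaming (_∈_ to _∈ₛ_)
open import Data.List.Base using (List; _++_; length; filter)
open import Data.Product.Base using (_×_; _,_; ∃-syntax)
open import Data.Sum.Base using (_⊎_)
open import Data.Vec.Base using (Vec; lookup; map; sum)
open import Function.Bundles using (_⇔_)
open import Relation.Binary.Bundles using (Setoid)
open import Relation.Binary.Definitions using (DecidableEquality)
import Relation.Binary.Construct.On as On
open import Relation.Binary.PropositionalEquality
  using (_≡_; _≢_; refl; sym; trans; setoid)
open import Relation.Nullary using (¬_; yes; no)
open import Relation.Unary using (Pred)

-- Positions and values of a permutation are numbered from 0 instead of 1,
-- which translates the plot by (-1 , -1).

Av312 : (n : ℕ) → Pred (Permutation′ n) 0ℓ
Av312 n π = ¬ (∃[ a ] ∃[ b ] ∃[ c ]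
  (a < b × b < c × π ⟨$⟩ʳ b < π ⟨$⟩ʳ c × π ⟨$⟩ʳ c < π ⟨$⟩ʳ a))

module _ {n : ℕ} (π : Permutation′ n) where

  -- i and i′ are consecutive positions, with i a descent.
  Descent : Fin n → Fin n → Set
  Descent i i′ = toℕ i′ ≡ suc (toℕ i) × π ⟨$⟩ʳ i′ < π ⟨$⟩ʳ i

  DescentTop : Fin n → Set
  DescentTop i = ∃[ i′ ] Descent i i′

  DescentBottom : Fin n → Set
  DescentBottom i′ = ∃[ i ] Descent i i′

-- Hooks live in the rational plane.  All their corners are lattice points and
-- their segments are parallel to the axes, so two of them meet in the real
-- plane exactly when they meet in the rational one.

Point : Set
Point = ℚ × ℚ

coord : ∀ {n} → Fin n → ℚ
coord i = fromℤ (+ toℕ i)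

module _ {n : ℕ} (π : Permutation′ n) where

  point : Fin n → Point
  point i = coord i , coord (π ⟨$⟩ʳ i)

  -- A hook is given by the positions i, j of its SW and NE endpoints.
  IsHook : Fin n → Fin n → Set
  IsHook i j = i < j × π ⟨$⟩ʳ i < π ⟨$⟩ʳ j

  OnVertical OnHorizontal OnHook : Fin n → Fin n → Point → Set
  OnVertical i j (x , y) =
    x ≡ coord i × coord (π ⟨$⟩ʳ i) ℚ.≤ y × y ℚ.≤ coord (π ⟨$⟩ʳ j)
  OnHorizontal i j (x , y) =
    y ≡ coord (π ⟨$⟩ʳ j) × coord i ℚ.≤ x × x ℚ.≤ coord j
  OnHook i j p = OnVertical i j p ⊎ OnHorizontal i j p

-- A finite set of pairs (SW position, NE position): row i is the set of NE
-- positions of the hooks with SW position i.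
HookSet : ℕ → Set
HookSet n = Vec (Subset n) n

infix 4 _∈_
_∈_ : ∀ {n} → Fin n × Fin n → HookSet n → Set
(i , j) ∈ H = j ∈ₛ lookup H i

#hooks : ∀ {n} → HookSet n → ℕ
#hooks H = sum (map ∣_∣ H)

record IsVHC {n : ℕ} (π : Permutation′ n) (H : HookSet n) : Set where
  field
    areHooks : ∀ i j → (i , j) ∈ H → IsHook π i j
    SW⇔top   : ∀ i → (∃[ j ] (i , j) ∈ H) ⇔ DescentTop π i
    noneAbove : ∀ i j → (i , j) ∈ H →
      ¬ (∃[ l ] (i < l × l < j × π ⟨$⟩ʳ j < π ⟨$⟩ʳ l))
    -- A common point of two distinct hooks must be the NE endpoint of one and
    -- the SW endpoint of the other.  This excludes two hooks with the same SW
    -- endpoint, and two with the same NE endpoint.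
    disjoint : ∀ i j i′ j′ → (i , j) ∈ H → (i′ , j′) ∈ H →
      (i , j) ≢ (i′ , j′) →
      ∀ p → OnHook π i j p → OnHook π i′ j′ p →
      (p ≡ point π j × p ≡ point π i′) ⊎ (p ≡ point π i × p ≡ point π j′)

IsReduced : {n : ℕ} → Permutation′ n → HookSet n → Set
IsReduced π H = ∀ l →
  (∃[ j ] (l , j) ∈ H) ⊎ (∃[ i ] (i , l) ∈ H) ⊎ DescentBottom π l

record RedVHC (k : ℕ) {n : ℕ} (S : Pred (Permutation′ n) 0ℓ) : Set where
  field
    perm    : Permutation′ n
    perm∈S  : S perm
    hooks   : HookSet n
    isVHC   : IsVHC perm hooks
    reduced : IsReduced perm hooks
    count   : #hooks hooks ≡ k

-- Two configurations are equal when they have the same underlying permutation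
-- (as a function) and the same set of hooks, irrespective of the proofs.
RedVHC-setoid : (k : ℕ) {n : ℕ} (S : Pred (Permutation′ n) 0ℓ) → Setoid 0ℓ 0ℓ
RedVHC-setoid k S = record
  { Carrier       = RedVHC k S
  ; _≈_           = λ C D → perm C ≈ perm D × hooks C ≡ hooks D
  ; isEquivalence = record
    { refl  = (λ _ → refl) , refl
    ; sym   = λ (p , h) → (λ i → sym (p i)) , sym h
    ; trans = λ (p , h) (q , g) → (λ i → trans (p i) (q i)) , trans h g
    }
  }
  where open RedVHC

data Letter : Set where
  X Y Z : Letter

_≟_ : DecidableEquality Letter
X ≟ X = yes refl
X ≟ Y = no λ ()
X ≟ Z = no λ ()
Y ≟ X = no λ ()
Y ≟ Y = yes refl
Y ≟ Z = no λ ()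
Z ≟ X = no λ ()
Z ≟ Y = no λ ()
Z ≟ Z = yes refl

#[_] : Letter → List Letter → ℕ
#[ a ] w = length (filter (a ≟_) w)

record Dyck³ (k : ℕ) : Set where
  field
    word     : List Letter
    length≡  : length word ≡ 3 * k
    #X       : #[ X ] word ≡ k
    #Y       : #[ Y ] word ≡ k
    #Z       : #[ Z ] word ≡ k
    prefixes : ∀ u v → word ≡ u ++ v →
      #[ Y ] u ≤ #[ X ] u × #[ Z ] u ≤ #[ Y ] u

-- Equality of the words alone, irrespective of the proofs.
Dyck³-setoid : (k : ℕ) → Setoid 0ℓ 0ℓ
Dyck³-setoid k = On.setoid (setoid (List Letter)) (Dyck³.word {k})

{-# OPTIONS --safe #-}

-- A configuration has k descent tops, k descent bottoms and k NE endpoints, which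
-- must cover 3k points, so every point has exactly one of these roles.  Reading the
-- points by increasing value and writing X for a descent bottom, Y for a descent top
-- and Z for an NE endpoint gives the word.  By 312-avoidance the Y- and Z-points
-- increase from left to right and the descents match the X's with later Y's without
-- crossings; as hooks do not meet, they match the Y's with later Z's without crossings.
-- So the word is a 3D-Dyck word.  Conversely such a word has exactly one noncrossing
-- matching of each kind; the first determines the permutation (each X-point stands
-- immediately after its Y-point), the second the hooks.

module Submission where

open import Defs
open import Data.Empty using (⊥; ⊥-elim)
open import Data.Fin.Base as Fin using (Fin; toℕ; fromℕ<)
open import Data.Fin.Permutation
  using (Permutation′; _⟨$⟩ʳ_; _⟨$⟩ˡ_; _≈_; permutation; inverseˡ; inverseʳ)
open import Data.Fin.Properties as Finₚ
  using (toℕ-injective; toℕ<n; toℕ-fromℕ<; injective⇒≤)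
open import Data.Fin.Subset using (Subset; ∣_∣; inside; outside; ⁅_⁆)
  renaming (_∈_ to _∈ₛ_; ⊥ to ∅)
open import Data.Fin.Subset.Properties using (⊆-antisym; ∉⊥; x∈⁅x⁆; x∈⁅y⁆⇒x≡y)
import Data.Integer.Base as ℤ
import Data.Integer.Properties as ℤₚ
open import Data.List.Base
  using (List; []; _∷_; _++_; length; lookup; filter; take; drop; tabulate; allFin;
         cartesianProduct)
  renaming (map to mapˡ)
open import Data.List.Membership.Propositional
  using (lose) renaming (_∈_ to _∈ˡ_; _∉_ to _∉ˡ_)
open import Data.List.Membership.Propositional.Properties
  using (∈-lookup; ∈-map⁺; ∈-map⁻; ∈-++⁺ˡ; ∈-++⁺ʳ; ∈-++⁻; ∈-filter⁺; ∈-filter⁻;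
         ∈-allFin; ∈-cartesianProduct⁺)
open import Data.List.Properties
  using (length-tabulate; length-map; length-++; filter-notAll; map-tabulate; take-map;
         take++drop≡id; ∷-injective; tabulate-cong; tabulate-lookup)
open import Data.List.Relation.Unary.All as All using ([]; _∷_)
open import Data.List.Relation.Unary.AllPairs using (AllPairs; []; _∷_)
open import Data.List.Relation.Unary.Any using (here; there; index)
open import Data.List.Relation.Unary.Any.Properties using (lookup-index)
open import Data.List.Relation.Unary.Unique.Propositional using (Unique)
import Data.List.Relation.Unary.Unique.Propositional.Properties as Unique
open import Data.Nat.Base
  using (ℕ; zero; suc; _+_; _*_; _≤_; _<_; z≤n; s≤s; s≤s⁻¹)
open import Data.Nat.Induction using (Acc; acc; <-wellFounded)
open import Data.Nat.Properties as ℕₚ hiding (_≟_)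
open import Data.Product.Base using (_×_; _,_; proj₁; proj₂; ∃; ∃-syntax; map₁)
open import Data.Product.Properties using (≡-dec)
import Data.Rational.Base as ℚ
open import Data.Sum.Base using (inj₁; inj₂)
open import Data.Vec.Base as Vec using (Vec; []; _∷_; sum)
open import Data.Vec.Properties as Vecₚ using (tabulate∘lookup; lookup∘tabulate)
open import Function.Base using (_∘_; id)
open import Function.Bundles using (Inverse; Equivalence; mk⇔)
open import Relation.Binary.Bundles using (Setoid)
open import Relation.Binary.Definitions using (tri<; tri≈; tri>)
open import Relation.Binary.PropositionalEquality
  using (_≡_; _≢_; refl; sym; trans; cong; cong₂; subst; subst₂; module ≡-Reasoning)
open import Relation.Nullary using (¬_; Dec; yes; no; contradiction; ¬?)

-- Descents and hooks both become `Matching` relations on values, so uniqueness of a noncrossing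
-- matching is proved once and serves both. A label is extracted from a proof that the configuration
-- is reduced; it is well defined only because no point has two roles. The obstacle to recovering
-- the permutation is that a word speaks of values and not of positions. `Before` therefore
-- expresses the left-to-right order through the labels and the descent matching alone, which makes
-- the map from configurations to words injective. For the bijection it then suffices that every
-- word has a preimage; the other composite follows from injectivity. The length `n` is kept apart
-- from `3 * k`, because the converse indexes points by the positions of the word itself.

-- Bounding lengths of lists by injective relations.

lookup-injective : {A : Set} {xs : List A} → Unique xs →
  ∀ i j → lookup xs i ≡ lookup xs j → i ≡ j
lookup-injective (_ ∷ _) Fin.zero    Fin.zero    _  = refl
lookup-injective {xs = x ∷ xs} (≢s ∷ _) Fin.zero    (Fin.suc j) eq =
  contradiction eq (All.lookup ≢s (∈-lookup j))
lookup-injective {xs = x ∷ xs} (≢s ∷ _) (Fin.suc i) Fin.zero    eq =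
  contradiction (sym eq) (All.lookup ≢s (∈-lookup i))
lookup-injective (_ ∷ uniq) (Fin.suc i) (Fin.suc j) eq =
  cong Fin.suc (lookup-injective uniq i j eq)

-- A relation replaces a function because partners come out of existential proofs; injectivity is
-- then asked of `R` and not of the choice.
pigeonhole-≤ : {A B : Set} {xs : List A} {ys : List B} (R : A → B → Set) →
  Unique xs →
  (∀ {x} → x ∈ˡ xs → ∃[ y ] (y ∈ˡ ys × R x y)) →
  (∀ {x x′ y} → R x y → R x′ y → x ≡ x′) →
  length xs ≤ length ys
pigeonhole-≤ {xs = xs} {ys} R uniq cover inj =
  injective⇒≤ {f = slot} λ {i} {j} eq → lookup-injective uniq i j
    (inj (R-slot i) (subst (R (lookup xs j) ∘ lookup ys) (sym eq) (R-slot j)))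
  where
  slot : Fin (length xs) → Fin (length ys)
  slot i = index (proj₁ (proj₂ (cover (∈-lookup i))))
  R-slot : ∀ i → R (lookup xs i) (lookup ys (slot i))
  R-slot i with cover (∈-lookup i)
  ... | y , y∈ , r = subst (R _) (lookup-index y∈) r

-- Noncrossing matchings and their uniqueness.

record Matching {n : ℕ} (lab : Fin n → Letter) (o c : Letter)
                (R : Fin n → Fin n → Set) : Set where
  field
    opener      : ∀ {p q} → R p q → lab p ≡ o
    closer      : ∀ {p q} → R p q → lab q ≡ c
    openTotal   : ∀ p → lab p ≡ o → ∃[ q ] R p q
    closeTotal  : ∀ q → lab q ≡ c → ∃[ p ] R p q
    order       : ∀ {p q} → R p q → p Fin.< q
    functional  : ∀ {p q q′} → R p q → R p q′ → q ≡ q′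
    injective   : ∀ {p p′ q} → R p q → R p′ q → p ≡ p′
    noncrossing : ∀ {p q p′ q′} → R p q → R p′ q′ →
                  p Fin.< p′ → p′ Fin.< q → q Fin.< q′ → ⊥

matching-cong : ∀ {n} {lab lab′ : Fin n → Letter} {o c R} →
  (∀ v → lab v ≡ lab′ v) → Matching lab o c R → Matching lab′ o c R
matching-cong lab≗ M = record
  { opener      = λ r → trans (sym (lab≗ _)) (opener r)
  ; closer      = λ r → trans (sym (lab≗ _)) (closer r)
  ; openTotal   = λ p p≡o → openTotal p (trans (lab≗ p) p≡o)
  ; closeTotal  = λ q q≡c → closeTotal q (trans (lab≗ q) q≡c)
  ; order       = order
  ; functional  = functional
  ; injective   = injective
  ; noncrossing = noncrossing
  }
  where open Matching M

-- The opener of q in one matching cannot lie inside the pair that closes at q in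
-- the other: it would be closed before q, where the two matchings agree.
matching-⊆-below : ∀ {n} {lab : Fin n → Letter} {o c R R′} →
  Matching lab o c R → Matching lab o c R′ → ∀ q →
  (∀ q₀ → q₀ Fin.< q → ∀ {p} → R p q₀ → R′ p q₀) →
  (∀ q₀ → q₀ Fin.< q → ∀ {p} → R′ p q₀ → R p q₀) →
  ∀ {p} → R p q → R′ p q
matching-⊆-below {R′ = R′} M M′ q R⇒R′ R′⇒R {p} r with Matching.closeTotal M′ q (Matching.closer M r)
... | p′ , r′ with Finₚ.<-cmp p p′
... | tri≈ _ refl _ = r′
... | tri< p<p′ _ _ with Matching.openTotal M p′ (Matching.opener M′ r′)
... | q₀ , r₀ with Finₚ.<-cmp q₀ q
... | tri< q₀<q q₀≢q _ =
  contradiction (Matching.functional M′ (R⇒R′ q₀ q₀<q r₀) r′) q₀≢q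
... | tri≈ _ refl _ = subst (λ x → R′ x q) (Matching.injective M r₀ r) r′
... | tri> _ _ q<q₀ =
  ⊥-elim (Matching.noncrossing M r r₀ p<p′ (Matching.order M′ r′) q<q₀)
matching-⊆-below {R′ = R′} M M′ q R⇒R′ R′⇒R {p} r | p′ , r′ | tri> _ _ p′<p
  with Matching.openTotal M′ p (Matching.opener M r)
... | q₀ , r₀ with Finₚ.<-cmp q₀ q
... | tri< q₀<q q₀≢q _ =
  contradiction (Matching.functional M (R′⇒R q₀ q₀<q r₀) r) q₀≢q
... | tri≈ _ refl _ = r₀
... | tri> _ _ q<q₀ =
  ⊥-elim (Matching.noncrossing M′ r′ r₀ p′<p (Matching.order M r) q<q₀)

-- Strong induction on the closer. Each step needs agreement in both directions at smaller closers,
-- so `go` quantifies over the two relations and calls itself with the matchings exchanged.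
matching-unique : ∀ {n} {lab : Fin n → Letter} {o c R R′} →
  Matching lab o c R → Matching lab o c R′ → ∀ {p q} → R p q → R′ p q
matching-unique M M′ {p} {q} = go M M′ q (<-wellFounded (toℕ q))
  where
  go : ∀ {n} {lab : Fin n → Letter} {o c R R′} →
    Matching lab o c R → Matching lab o c R′ → ∀ q → Acc _<_ (toℕ q) →
    ∀ {p} → R p q → R′ p q
  go M M′ q (acc rs) = matching-⊆-below M M′ q
    (λ q₀ q₀<q → go M M′ q₀ (rs q₀<q)) (λ q₀ q₀<q → go M′ M q₀ (rs q₀<q))

-- Letter counts of prefixes.

δ : Letter → Letter → ℕ
δ a b with a ≟ b
... | yes _ = 1
... | no _  = 0

δ-≡ : ∀ {a b} → a ≡ b → δ a b ≡ 1
δ-≡ {a} {b} a≡b with a ≟ b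
... | yes _   = refl
... | no a≢b = contradiction a≡b a≢b

δ-≢ : ∀ {a b} → a ≢ b → δ a b ≡ 0
δ-≢ {a} {b} a≢b with a ≟ b
... | yes a≡b = contradiction a≡b a≢b
... | no _    = refl

#-∷ : ∀ a b w → #[ a ] (b ∷ w) ≡ δ a b + #[ a ] w
#-∷ a b w with a ≟ b
... | yes _ = refl
... | no _  = refl

letterAt : List Letter → ℕ → Letter
-- An arbitrary value: words are only read at indices below their length.
letterAt []      _       = X
letterAt (a ∷ w) zero    = a
letterAt (a ∷ w) (suc i) = letterAt w i

letterAt-lookup : ∀ w i → letterAt w (toℕ i) ≡ lookup w i
letterAt-lookup (a ∷ w) Fin.zero    = refl
letterAt-lookup (a ∷ w) (Fin.suc i) = letterAt-lookup w i

occurrences : Letter → (ℕ → Letter) → ℕ → ℕ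
occurrences a f zero    = 0
occurrences a f (suc t) = δ a (f t) + occurrences a f t

-- `occurrences` splits off the last letter, as the stack does, while list counts split off the
-- first; this reconciles the two.
occurrences-∷ : ∀ a f t →
  occurrences a f (suc t) ≡ δ a (f 0) + occurrences a (f ∘ suc) t
occurrences-∷ a f zero    = refl
occurrences-∷ a f (suc t) = begin
  δ a (f (suc t)) + occurrences a f (suc t)
    ≡⟨ cong (δ a (f (suc t)) +_) (occurrences-∷ a f t) ⟩
  δ a (f (suc t)) + (δ a (f 0) + occurrences a (f ∘ suc) t)
    ≡⟨ +-assoc (δ a (f (suc t))) _ _ ⟨
  δ a (f (suc t)) + δ a (f 0) + occurrences a (f ∘ suc) t
    ≡⟨ cong (_+ occurrences a (f ∘ suc) t) (+-comm (δ a (f (suc t))) _) ⟩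
  δ a (f 0) + δ a (f (suc t)) + occurrences a (f ∘ suc) t
    ≡⟨ +-assoc (δ a (f 0)) _ _ ⟩
  δ a (f 0) + occurrences a (f ∘ suc) (suc t) ∎
  where open ≡-Reasoning

#-take : ∀ a w t → t ≤ length w → #[ a ] (take t w) ≡ occurrences a (letterAt w) t
#-take a w       zero    _         = refl
#-take a (b ∷ w) (suc t) (s≤s t≤n) = begin
  #[ a ] (b ∷ take t w)                ≡⟨ #-∷ a b (take t w) ⟩
  δ a b + #[ a ] (take t w)            ≡⟨ cong (δ a b +_) (#-take a w t t≤n) ⟩
  δ a b + occurrences a (letterAt w) t ≡⟨ occurrences-∷ a (letterAt (b ∷ w)) t ⟨
  occurrences a (letterAt (b ∷ w)) (suc t) ∎
  where open ≡-Reasoning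

-- Constructing a matching with a stack.

-- Stack o c f t s : reading f 0, …, f (t - 1), with o pushing its index and c
-- popping, leaves the stack s of the indices of the unmatched o's.
data Stack (o c : Letter) (f : ℕ → Letter) : ℕ → List ℕ → Set where
  start : Stack o c f 0 []
  push  : ∀ {t s} → Stack o c f t s → f t ≡ o → Stack o c f (suc t) (t ∷ s)
  pop   : ∀ {t p s} → Stack o c f t (p ∷ s) → f t ≡ c → Stack o c f (suc t) s
  skip  : ∀ {t s} → Stack o c f t s → f t ≢ o → f t ≢ c → Stack o c f (suc t) s

module _ {o c : Letter} (o≢c : o ≢ c) {f : ℕ → Letter} where

  stack-deterministic : ∀ {t s s′} → Stack o c f t s → Stack o c f t s′ → s ≡ s′
  stack-deterministic start start = refl
  stack-deterministic (push S _) (push S′ _) = cong (_ ∷_) (stack-deterministic S S′)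
  stack-deterministic (push _ o≡) (pop _ c≡) = contradiction (trans (sym o≡) c≡) o≢c
  stack-deterministic (push _ o≡) (skip _ ≢o _) = contradiction o≡ ≢o
  stack-deterministic (pop _ c≡) (push _ o≡) = contradiction (trans (sym o≡) c≡) o≢c
  stack-deterministic (pop S _) (pop S′ _) with stack-deterministic S S′
  ... | refl = refl
  stack-deterministic (pop _ c≡) (skip _ _ ≢c) = contradiction c≡ ≢c
  stack-deterministic (skip _ ≢o _) (push _ o≡) = contradiction o≡ ≢o
  stack-deterministic (skip _ _ ≢c) (pop _ c≡) = contradiction c≡ ≢c
  stack-deterministic (skip S _ _) (skip S′ _ _) = stack-deterministic S S′

  stack-opener : ∀ {t s p} → Stack o c f t s → p ∈ˡ s → f p ≡ o
  stack-opener (push S o≡)  (here refl) = o≡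
  stack-opener (push S _)   (there p∈)  = stack-opener S p∈
  stack-opener (pop S _)    p∈          = stack-opener S (there p∈)
  stack-opener (skip S _ _) p∈          = stack-opener S p∈

  stack-< : ∀ {t s p} → Stack o c f t s → p ∈ˡ s → p < t
  stack-< (push S o≡)  (here refl) = ≤-refl
  stack-< (push S _)   (there p∈)  = m<n⇒m<1+n (stack-< S p∈)
  stack-< (pop S _)    p∈          = m<n⇒m<1+n (stack-< S (there p∈))
  stack-< (skip S _ _) p∈          = m<n⇒m<1+n (stack-< S p∈)

  stack-sorted : ∀ {t s} → Stack o c f t s → AllPairs (λ p q → q < p) s
  stack-sorted start         = []
  stack-sorted (push S _)    = All.tabulate (stack-< S) ∷ stack-sorted S
  stack-sorted (pop S _) with stack-sorted S
  ... | _ ∷ sorted = sorted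
  stack-sorted (skip S _ _)  = stack-sorted S

  -- Going back from `t′` to `t`, an entry can only disappear at its own push, which happens at
  -- index `p` and hence before `t`.
  stack-persist : ∀ {t s t′ s′ p} → Stack o c f t s → Stack o c f t′ s′ →
    t ≤ t′ → p ∈ˡ s′ → p < t → p ∈ˡ s
  stack-persist S S′ t≤t′ p∈ p<t with m≤n⇒m<n∨m≡n t≤t′
  ... | inj₂ refl rewrite stack-deterministic S S′ = p∈
  stack-persist S (push S′ _) _ (here refl) p<t | inj₁ t<t′ =
    contradiction (≤-trans p<t (s≤s⁻¹ t<t′)) (<-irrefl refl)
  stack-persist S (push S′ _) _ (there p∈) p<t | inj₁ t<t′ =
    stack-persist S S′ (s≤s⁻¹ t<t′) p∈ p<t
  stack-persist S (pop S′ _) _ p∈ p<t | inj₁ t<t′ =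
    stack-persist S S′ (s≤s⁻¹ t<t′) (there p∈) p<t
  stack-persist S (skip S′ _ _) _ p∈ p<t | inj₁ t<t′ =
    stack-persist S S′ (s≤s⁻¹ t<t′) p∈ p<t

  -- The usual parenthesis matching: reading the closer at `q` removes the top entry `p`.
  Popped : ℕ → ℕ → Set
  Popped p q = f q ≡ c × ∃[ s ] Stack o c f q (p ∷ s)

  popped-injective : ∀ {p p′ q} → Popped p q → Popped p′ q → p ≡ p′
  popped-injective (_ , _ , S) (_ , _ , S′) with stack-deterministic S S′
  ... | refl = refl

  -- What remains after the first pop lies strictly below `p`, yet by persistence it would still
  -- contain `p`.
  popped-once : ∀ {p q q′} → Popped p q → Popped p q′ → ¬ q < q′
  popped-once (c≡ , s , S) (_ , s′ , S′) q<q′ with stack-sorted S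
  ... | s<p ∷ _ = <-irrefl refl (All.lookup s<p
    (stack-persist (pop S c≡) S′ q<q′ (here refl) (m<n⇒m<1+n (stack-< S (here refl)))))

  -- Since `p′` precedes `q`, it is already on the stack at `q`, where the larger entry `p′` cannot
  -- lie under the top `p`.
  popped-noncrossing : ∀ {p q p′ q′} → Popped p q → Popped p′ q′ →
    p < p′ → p′ < q → q < q′ → ⊥
  popped-noncrossing (_ , s , S) (_ , s′ , S′) p<p′ p′<q q<q′
    with stack-sorted S | stack-persist S S′ (<⇒≤ q<q′) (here refl) p′<q
  ... | s<p ∷ _ | here refl = <-irrefl refl p<p′
  ... | s<p ∷ _ | there p′∈ = <-asym p<p′ (All.lookup s<p p′∈)

  -- Some step between `t` and `t′` removes `p`, and only a pop of `p` itself can do so.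
  popped-between : ∀ {t s t′ s′ p} → Stack o c f t s → Stack o c f t′ s′ →
    t ≤ t′ → p ∈ˡ s → p ∉ˡ s′ → ∃[ q ] (q < t′ × Popped p q)
  popped-between S S′ t≤t′ p∈ p∉ with m≤n⇒m<n∨m≡n t≤t′
  ... | inj₂ refl rewrite stack-deterministic S S′ = contradiction p∈ p∉
  popped-between S (push S′ _) _ p∈ p∉ | inj₁ t<t′
    with popped-between S S′ (s≤s⁻¹ t<t′) p∈ (p∉ ∘ there)
  ... | q , q<t′ , popped = q , m<n⇒m<1+n q<t′ , popped
  popped-between S (skip S′ _ _) _ p∈ p∉ | inj₁ t<t′
    with popped-between S S′ (s≤s⁻¹ t<t′) p∈ p∉
  ... | q , q<t′ , popped = q , m<n⇒m<1+n q<t′ , popped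
  popped-between {p = p} S (pop {t} {p′} {s} S′ c≡) _ p∈ p∉ | inj₁ t<t′ with p ℕₚ.≟ p′
  ... | yes refl = t , ≤-refl , c≡ , s , S′
  ... | no p≢p′ with popped-between S S′ (s≤s⁻¹ t<t′) p∈ (λ { (here p≡p′) → p≢p′ p≡p′ ; (there p∈s) → p∉ p∈s })
  ... | q , q<t′ , popped = q , m<n⇒m<1+n q<t′ , popped

  module _ {n : ℕ}
    (ballot : ∀ t → t ≤ n → occurrences c f t ≤ occurrences o f t) where

    -- The stack length is the excess of openers over closers. On an empty stack the counts agree,
    -- so one more closer would violate the ballot inequality at `suc t`.
    stack-exists : ∀ t → t ≤ n →
      ∃[ s ] (Stack o c f t s × length s + occurrences c f t ≡ occurrences o f t)
    stack-exists zero    _   = [] , start , refl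
    stack-exists (suc t) t<n with stack-exists t (<⇒≤ t<n)
    ... | s , S , eq with o ≟ f t | c ≟ f t
    ... | yes o≡ | yes c≡ = contradiction (trans o≡ (sym c≡)) o≢c
    ... | yes o≡ | no _ = t ∷ s , push S (sym o≡) , cong suc eq
    ... | no o≢ | no c≢ = s , skip S (o≢ ∘ sym) (c≢ ∘ sym) , eq
    stack-exists (suc t) t<n | p ∷ s , S , eq | no _ | yes c≡ =
      s , pop S (sym c≡) , trans (+-suc (length s) _) eq
    stack-exists (suc t) t<n | [] , S , eq | no o≢ | yes c≡ =
      contradiction (ballot (suc t) t<n) (<⇒≱ (subst₂ _<_
        (cong (_+ occurrences o f t) (sym (δ-≢ o≢)))
        (cong₂ _+_ (sym (δ-≡ c≡)) refl)
        (s≤s (≤-reflexive (sym eq)))))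

    module _ (balanced : occurrences c f n ≡ occurrences o f n)
      {lab : Fin n → Letter} (f≗lab : ∀ i → f (toℕ i) ≡ lab i) where

      -- The ballot condition gives every closer something to pop; balance empties the final stack,
      -- so every opener is popped.
      stack-matching : Matching lab o c (λ p q → Popped (toℕ p) (toℕ q))
      stack-matching = record
        { opener = λ { {p} (_ , _ , S) → trans (sym (f≗lab p)) (stack-opener S (here refl)) }
        ; closer = λ { {q = q} (c≡ , _) → trans (sym (f≗lab q)) c≡ }
        ; openTotal = openTotal
        ; closeTotal = closeTotal
        ; order = λ { (_ , _ , S) → stack-< S (here refl) }
        ; functional = λ r r′ → functional r r′
        ; injective = λ r r′ → toℕ-injective (popped-injective r r′)
        ; noncrossing = popped-noncrossing
        }
        where
        functional : ∀ {p q q′} → Popped p (toℕ q) → Popped p (toℕ q′) → q ≡ q′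
        functional {q = q} {q′} r r′ with Finₚ.<-cmp q q′
        ... | tri< q<q′ _ _ = contradiction q<q′ (popped-once r r′)
        ... | tri≈ _ q≡q′ _ = q≡q′
        ... | tri> _ _ q′<q = contradiction q′<q (popped-once r′ r)

        closeTotal : ∀ q → lab q ≡ c → ∃[ p ] Popped (toℕ p) (toℕ q)
        closeTotal q q≡c with stack-exists (toℕ q) (<⇒≤ (toℕ<n q))
        ... | p ∷ s , S , _ = fromℕ< p<n ,
            subst (λ x → Popped x (toℕ q)) (sym (toℕ-fromℕ< p<n))
              (trans (f≗lab q) q≡c , s , S)
          where
          p<n : p < n
          p<n = <-trans (stack-< S (here refl)) (toℕ<n q)
        ... | [] , S , eq = contradiction (ballot (suc (toℕ q)) (toℕ<n q))
          (<⇒≱ (subst₂ _<_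
            (cong (_+ occurrences o f (toℕ q)) (sym (δ-≢ {o} λ o≡ → o≢c (trans o≡ (trans (f≗lab q) q≡c)))))
            (cong (_+ occurrences c f (toℕ q)) (sym (δ-≡ {c} (sym (trans (f≗lab q) q≡c)))))
            (s≤s (≤-reflexive (sym eq)))))

        openTotal : ∀ p → lab p ≡ o → ∃[ q ] Popped (toℕ p) (toℕ q)
        openTotal p p≡o
          with stack-exists (toℕ p) (<⇒≤ (toℕ<n p)) | stack-exists n ≤-refl
        ... | _ , _ , _ | _ ∷ s , _ , eq =
          contradiction (trans balanced (sym eq)) (m≢1+n+m _)
        ... | s , S , _ | [] , S′ , _
          -- The index `p` is on the stack right after its push and absent from the empty final one.
          with popped-between (push S (trans (f≗lab p) p≡o)) S′ (toℕ<n p) (here refl) (λ ())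
        ... | q , q<n , popped =
          fromℕ< q<n , subst (Popped (toℕ p)) (sym (toℕ-fromℕ< q<n)) popped

-- Listing the hooks.

elements : ∀ {n} → Subset n → List (Fin n)
elements []            = []
elements (inside ∷ p)  = Fin.zero ∷ mapˡ Fin.suc (elements p)
elements (outside ∷ p) = mapˡ Fin.suc (elements p)

length-elements : ∀ {n} (p : Subset n) → length (elements p) ≡ ∣ p ∣
length-elements []            = refl
length-elements (inside ∷ p)  = cong suc (trans (length-map Fin.suc (elements p)) (length-elements p))
length-elements (outside ∷ p) = trans (length-map Fin.suc (elements p)) (length-elements p)

∈-elements⁺ : ∀ {n i} {p : Subset n} → i ∈ₛ p → i ∈ˡ elements p
∈-elements⁺ {p = inside ∷ p}  Vec.here       = here refl
∈-elements⁺ {p = inside ∷ p}  (Vec.there i∈) = there (∈-map⁺ Fin.suc (∈-elements⁺ i∈))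
∈-elements⁺ {p = outside ∷ p} (Vec.there i∈) = ∈-map⁺ Fin.suc (∈-elements⁺ i∈)

∈-elements⁻ : ∀ {n i} {p : Subset n} → i ∈ˡ elements p → i ∈ₛ p
∈-elements⁻ {p = inside ∷ p}  (here refl) = Vec.here
∈-elements⁻ {p = inside ∷ p}  (there i∈) with ∈-map⁻ Fin.suc i∈
... | _ , j∈ , refl = Vec.there (∈-elements⁻ j∈)
∈-elements⁻ {p = outside ∷ p} i∈ with ∈-map⁻ Fin.suc i∈
... | _ , j∈ , refl = Vec.there (∈-elements⁻ j∈)

elements-unique : ∀ {n} (p : Subset n) → Unique (elements p)
elements-unique []            = []
elements-unique (inside ∷ p)  =
  All.tabulate (λ { i∈ refl → 0∉ (∈-map⁻ Fin.suc i∈) }) ∷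
  Unique.map⁺ Finₚ.suc-injective (elements-unique p)
  where
  0∉ : ¬ (∃[ j ] (j ∈ˡ elements p × Fin.zero ≡ Fin.suc j))
  0∉ (_ , _ , ())
elements-unique (outside ∷ p) = Unique.map⁺ Finₚ.suc-injective (elements-unique p)

inFirstRow : ∀ {m n} → Fin n → Fin (suc m) × Fin n
inFirstRow j = Fin.zero , j

-- The number of rows is separated from the number of columns because the recursion shrinks only the
-- former.
hookList : ∀ {m n} → Vec (Subset n) m → List (Fin m × Fin n)
hookList []      = []
hookList (p ∷ H) = mapˡ inFirstRow (elements p) ++ mapˡ (map₁ Fin.suc) (hookList H)

length-hookList : ∀ {m n} (H : Vec (Subset n) m) →
  length (hookList H) ≡ sum (Vec.map ∣_∣ H)
length-hookList []      = refl
length-hookList (p ∷ H) = trans (length-++ (mapˡ inFirstRow (elements p)))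
  (cong₂ _+_ (trans (length-map inFirstRow (elements p)) (length-elements p))
             (trans (length-map (map₁ Fin.suc) (hookList H)) (length-hookList H)))

∈-hookList⁺ : ∀ {m n} (H : Vec (Subset n) m) i {j} →
  j ∈ₛ Vec.lookup H i → (i , j) ∈ˡ hookList H
∈-hookList⁺ (p ∷ H) Fin.zero    j∈ = ∈-++⁺ˡ (∈-map⁺ inFirstRow (∈-elements⁺ j∈))
∈-hookList⁺ (p ∷ H) (Fin.suc i) j∈ =
  ∈-++⁺ʳ _ (∈-map⁺ (map₁ Fin.suc) (∈-hookList⁺ H i j∈))

∈-hookList⁻ : ∀ {m n} (H : Vec (Subset n) m) {i j} →
  (i , j) ∈ˡ hookList H → j ∈ₛ Vec.lookup H i
∈-hookList⁻ (p ∷ H) ij∈ with ∈-++⁻ (mapˡ inFirstRow (elements p)) ij∈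
... | inj₁ ij∈p with ∈-map⁻ inFirstRow ij∈p
... | _ , j∈ , refl = ∈-elements⁻ j∈
∈-hookList⁻ (p ∷ H) ij∈ | inj₂ ij∈H with ∈-map⁻ (map₁ Fin.suc) ij∈H
... | _ , ij∈′ , refl = ∈-hookList⁻ H ij∈′

hookList-unique : ∀ {m n} (H : Vec (Subset n) m) → Unique (hookList H)
hookList-unique []      = []
hookList-unique (p ∷ H) = Unique.++⁺
  (Unique.map⁺ (λ { refl → refl }) (elements-unique p))
  (Unique.map⁺ (λ { refl → refl }) (hookList-unique H))
  λ (∈p , ∈H) → disjoint (∈-map⁻ inFirstRow ∈p) (∈-map⁻ (map₁ Fin.suc) ∈H)
  where
  disjoint : ∀ {x} → ∃[ j ] (j ∈ˡ elements p × x ≡ (Fin.zero , j)) →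
    ¬ (∃[ y ] (y ∈ˡ hookList H × x ≡ map₁ Fin.suc y))
  disjoint (_ , _ , refl) (_ , _ , ())

-- Matchings give ballot words.

∈-take-tabulate⁺ : ∀ {A : Set} {n} (f : Fin n → A) t i →
  toℕ i < t → f i ∈ˡ take t (tabulate f)
∈-take-tabulate⁺ f (suc t) Fin.zero    _         = here refl
∈-take-tabulate⁺ f (suc t) (Fin.suc i) (s≤s i<t) =
  there (∈-take-tabulate⁺ (f ∘ Fin.suc) t i i<t)

∈-take-tabulate⁻ : ∀ {A : Set} {n} (f : Fin n → A) t {x} →
  x ∈ˡ take t (tabulate f) → ∃[ i ] (toℕ i < t × x ≡ f i)
∈-take-tabulate⁻ {n = suc _} f (suc t) (here refl) = Fin.zero , s≤s z≤n , refl
∈-take-tabulate⁻ {n = suc _} f (suc t) (there x∈) with ∈-take-tabulate⁻ (f ∘ Fin.suc) t x∈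
... | i , i<t , refl = Fin.suc i , s≤s i<t , refl

#-map : ∀ {A : Set} a (lab : A → Letter) us →
  #[ a ] (mapˡ lab us) ≡ length (filter (λ u → a ≟ lab u) us)
#-map a lab []       = refl
#-map a lab (u ∷ us) with a ≟ lab u
... | yes _ = cong suc (#-map a lab us)
... | no _  = #-map a lab us

#-take-tabulate : ∀ {n} a (lab : Fin n → Letter) t →
  #[ a ] (take t (tabulate lab)) ≡ length (filter (λ i → a ≟ lab i) (take t (allFin n)))
#-take-tabulate {n} a lab t = begin
  #[ a ] (take t (tabulate lab))         ≡⟨ cong (#[ a ] ∘ take t) (map-tabulate id lab) ⟨
  #[ a ] (take t (mapˡ lab (allFin n)))  ≡⟨ cong #[ a ] (take-map t (allFin n)) ⟩
  #[ a ] (mapˡ lab (take t (allFin n)))  ≡⟨ #-map a lab (take t (allFin n)) ⟩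
  length (filter (λ i → a ≟ lab i) (take t (allFin n))) ∎
  where open ≡-Reasoning

#-tabulate : ∀ {n} a (lab : Fin n → Letter) →
  #[ a ] (tabulate lab) ≡ length (filter (λ i → a ≟ lab i) (allFin n))
#-tabulate {n} a lab = trans (cong #[ a ] (sym (map-tabulate id lab))) (#-map a lab (allFin n))

#-total : ∀ w → #[ X ] w + #[ Y ] w + #[ Z ] w ≡ length w
#-total []      = refl
#-total (X ∷ w) = cong suc (#-total w)
#-total (Y ∷ w) = trans (cong (_+ #[ Z ] w) (+-suc (#[ X ] w) _)) (cong suc (#-total w))
#-total (Z ∷ w) = trans (+-suc (#[ X ] w + #[ Y ] w) _) (cong suc (#-total w))

module _ {n} {lab : Fin n → Letter} {o c R} (M : Matching lab o c R) where
  open Matching M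

  -- An opener precedes its closer, so a prefix containing the closer contains the opener too.
  closers≤openers : ∀ t → #[ c ] (take t (tabulate lab)) ≤ #[ o ] (take t (tabulate lab))
  closers≤openers t = subst₂ _≤_
    (sym (#-take-tabulate c lab t)) (sym (#-take-tabulate o lab t))
    (pigeonhole-≤ (λ q p → R p q)
      (Unique.filter⁺ (λ i → c ≟ lab i) (Unique.take⁺ t (Unique.allFin⁺ n)))
      cover functional)
    where
    cover : ∀ {q} → q ∈ˡ filter (λ i → c ≟ lab i) (take t (allFin n)) →
      ∃[ p ] (p ∈ˡ filter (λ i → o ≟ lab i) (take t (allFin n)) × R p q)
    cover q∈ with ∈-filter⁻ (λ i → c ≟ lab i) {xs = take t (allFin n)} q∈
    ... | q∈t , c≡ with ∈-take-tabulate⁻ id t q∈t | closeTotal _ (sym c≡)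
    ... | q , q<t , refl | p , r = p , ∈-filter⁺ (λ i → o ≟ lab i)
      (∈-take-tabulate⁺ id t p (<-trans (order r) q<t)) (sym (opener r)) , r

  openers≤closers : #[ o ] (tabulate lab) ≤ #[ c ] (tabulate lab)
  openers≤closers = subst₂ _≤_ (sym (#-tabulate o lab)) (sym (#-tabulate c lab))
    (pigeonhole-≤ R (Unique.filter⁺ (λ i → o ≟ lab i) (Unique.allFin⁺ n)) cover injective)
    where
    cover : ∀ {p} → p ∈ˡ filter (λ i → o ≟ lab i) (allFin n) →
      ∃[ q ] (q ∈ˡ filter (λ i → c ≟ lab i) (allFin n) × R p q)
    cover {p} p∈ with ∈-filter⁻ (λ i → o ≟ lab i) {xs = allFin n} p∈
    ... | _ , o≡ with openTotal p (sym o≡)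
    ... | q , r = q , ∈-filter⁺ (λ i → c ≟ lab i) (∈-allFin q) (sym (closer r)) , r

-- Coordinates, and counting the roles of points.

length-cartesianProduct : ∀ {A B : Set} (xs : List A) (ys : List B) →
  length (cartesianProduct xs ys) ≡ length xs * length ys
length-cartesianProduct []       ys = refl
length-cartesianProduct (x ∷ xs) ys = trans (length-++ (mapˡ (x ,_) ys))
  (cong₂ _+_ (length-map (x ,_) ys) (length-cartesianProduct xs ys))

coord-injective : ∀ {n} {i j : Fin n} → coord i ≡ coord j → i ≡ j
coord-injective eq = toℕ-injective (ℤₚ.+-injective (cong ℚ.ℚ.numerator eq))

coord-mono : ∀ {m n} {i : Fin m} {j : Fin n} → toℕ i ≤ toℕ j → coord i ℚ.≤ coord j
coord-mono {i = i} {j} i≤j = ℚ.*≤* (subst₂ ℤ._≤_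
  (sym (ℤₚ.*-identityʳ (ℤ.+ toℕ i))) (sym (ℤₚ.*-identityʳ (ℤ.+ toℕ j))) (ℤ.+≤+ i≤j))

coord-cancel-≤ : ∀ {m n} {i : Fin m} {j : Fin n} → coord i ℚ.≤ coord j → toℕ i ≤ toℕ j
coord-cancel-≤ {i = i} {j} (ℚ.*≤* le) = ℤₚ.drop‿+≤+ (subst₂ ℤ._≤_
  (ℤₚ.*-identityʳ (ℤ.+ toℕ i)) (ℤₚ.*-identityʳ (ℤ.+ toℕ j)) le)

-- The hook endpoints and descent bottoms attached to a hook from i to j: its
-- SW endpoint (Y), its NE endpoint (Z) and the descent bottom following i (X).
Role : ∀ {n} → Permutation′ n → Fin n → (Fin n × Fin n) × Letter → Set
Role π x ((i , j) , X) = Descent π i x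
Role π x ((i , j) , Y) = x ≡ i
Role π x ((i , j) , Z) = x ≡ j

role-injective : ∀ {n} (π : Permutation′ n) {x x′} s → Role π x s → Role π x′ s → x ≡ x′
role-injective π (_ , X) (eq , _) (eq′ , _) = toℕ-injective (trans eq (sym eq′))
role-injective π (_ , Y) eq eq′ = trans eq (sym eq′)
role-injective π (_ , Z) eq eq′ = trans eq (sym eq′)

module _ {n : ℕ} {π : Permutation′ n} {H : HookSet n} where

  role-exists : IsVHC π H → IsReduced π H →
    ∀ x → ∃[ s ] (proj₁ s ∈ H × Role π x s)
  role-exists vhc red x with red x
  ... | inj₁ (j , h)        = ((x , j) , Y) , h , refl
  ... | inj₂ (inj₁ (i , h)) = ((i , x) , Z) , h , refl
  ... | inj₂ (inj₂ (i , d)) with Equivalence.from (IsVHC.SW⇔top vhc i) (x , d)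
  ... | j , h = ((i , j) , X) , h , d

  slots : List ((Fin n × Fin n) × Letter)
  slots = cartesianProduct (hookList H) (X ∷ Y ∷ Z ∷ [])

  length-slots : length slots ≡ length (hookList H) * 3
  length-slots = length-cartesianProduct (hookList H) (X ∷ Y ∷ Z ∷ [])

  ∈-slots : ∀ s → proj₁ s ∈ H → s ∈ˡ slots
  ∈-slots ((i , j) , a) h = ∈-cartesianProduct⁺ (∈-hookList⁺ H i h) (letter a)
    where
    letter : ∀ a → a ∈ˡ (X ∷ Y ∷ Z ∷ [])
    letter X = here refl
    letter Y = there (here refl)
    letter Z = there (there (here refl))

  -- Each hook provides three slots and each slot holds at most one point. For a constructed
  -- configuration the same bound shows that there are at least k hooks.
  n≤3*hooks : IsVHC π H → IsReduced π H → n ≤ length (hookList H) * 3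
  n≤3*hooks vhc red = subst₂ _≤_ (length-tabulate {n = n} id) length-slots
    (pigeonhole-≤ (Role π) (Unique.allFin⁺ n) cover (λ {_} {_} {s} → role-injective π s))
    where
    cover : ∀ {x} → x ∈ˡ allFin n → ∃[ s ] (s ∈ˡ slots × Role π x s)
    cover {x} _ with role-exists vhc red x
    ... | s , h , r = s , ∈-slots s h , r

  -- With only 3k slots for 3k points, no slot can be spared.
  role-unique : IsVHC π H → IsReduced π H → length (hookList H) * 3 ≤ n →
    ∀ {x s s′} → proj₁ s ∈ H → Role π x s → proj₁ s′ ∈ H → Role π x s′ → s ≡ s′
  role-unique vhc red 3k≤n {x} {s} {s′} h r h′ r′ with ≡-dec (≡-dec Finₚ._≟_ Finₚ._≟_) _≟_ s s′
  ... | yes s≡s′ = s≡s′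
  ... | no s≢s′  = contradiction (≤-trans (≤-reflexive length-slots) 3k≤n)
    (<⇒≱ (≤-<-trans
      (subst (_≤ length others) (length-tabulate {n = n} id)
        (pigeonhole-≤ (Role π) (Unique.allFin⁺ n) cover (λ {_} {_} {s} → role-injective π s)))
      (filter-notAll other? slots (lose (∈-slots s′ h′) (λ s′≢s′ → s′≢s′ refl)))))
    where
    other? = λ y → ¬? (≡-dec (≡-dec Finₚ._≟_ Finₚ._≟_) _≟_ y s′)
    others : List ((Fin n × Fin n) × Letter)
    others = filter other? slots
    cover : ∀ {y} → y ∈ˡ allFin n → ∃[ u ] (u ∈ˡ others × Role π y u)
    cover {y} _ with role-exists vhc red y
    ... | u , hᵤ , rᵤ with ≡-dec (≡-dec Finₚ._≟_ Finₚ._≟_) _≟_ u s′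
    ... | no u≢s′  = u , ∈-filter⁺ other? (∈-slots u hᵤ) u≢s′ , rᵤ
    ... | yes refl = s , ∈-filter⁺ other? (∈-slots s h) s≢s′ ,
      subst (λ z → Role π z s) (role-injective π s′ r′ rᵤ) r

-- Labels and matchings of a configuration.

⟨$⟩ʳ-injective : ∀ {n} (π : Permutation′ n) {x y} → π ⟨$⟩ʳ x ≡ π ⟨$⟩ʳ y → x ≡ y
⟨$⟩ʳ-injective π eq = trans (sym (inverseˡ π)) (trans (cong (π ⟨$⟩ˡ_) eq) (inverseˡ π))

predecessor : ∀ {n} {x y : Fin n} → x Fin.< y →
  ∃ λ (z : Fin n) → toℕ y ≡ suc (toℕ z) × toℕ x ≤ toℕ z
predecessor {y = Fin.suc y} x<y =
  Fin.inject₁ y , cong suc (sym (Finₚ.toℕ-inject₁ y)) ,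
  subst (_ ≤_) (sym (Finₚ.toℕ-inject₁ y)) (s≤s⁻¹ x<y)

module Labelling {n : ℕ} {π : Permutation′ n} {H : HookSet n}
  (av : Av312 n π) (vhc : IsVHC π H) (red : IsReduced π H)
  (tight : length (hookList H) * 3 ≤ n) where
  open IsVHC vhc

  pos : Fin n → Fin n
  pos v = π ⟨$⟩ˡ v

  val : Fin n → Fin n
  val x = π ⟨$⟩ʳ x

  val-pos : ∀ v → val (pos v) ≡ v
  val-pos _ = inverseʳ π

  pos-injective : ∀ {u v} → pos u ≡ pos v → u ≡ v
  pos-injective {u} {v} eq = trans (sym (val-pos u)) (trans (cong val eq) (val-pos v))

  -- The letter of whichever role the proofs select; by `kind-role` any other role of `x` has the
  -- same letter.
  kind : Fin n → Letter
  kind x = proj₂ (proj₁ (role-exists vhc red x))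

  kind-role : ∀ {x i j} a → (i , j) ∈ H → Role π x ((i , j) , a) → kind x ≡ a
  kind-role {x} a h r with role-exists vhc red x
  ... | s , h′ , r′ = cong proj₂ (role-unique vhc red tight h′ r′ h r)

  X-descent : ∀ {x} → kind x ≡ X → ∃[ i ] ∃[ j ] ((i , j) ∈ H × Descent π i x)
  X-descent {x} eq with role-exists vhc red x | eq
  ... | ((i , j) , .X) , h , r | refl = i , j , h , r

  Y-hook : ∀ {x} → kind x ≡ Y → ∃[ j ] (x , j) ∈ H
  Y-hook {x} eq with role-exists vhc red x | eq
  ... | ((i , j) , .Y) , h , refl | refl = j , h

  Z-hook : ∀ {x} → kind x ≡ Z → ∃[ i ] (i , x) ∈ H
  Z-hook {x} eq with role-exists vhc red x | eq
  ... | ((i , j) , .Z) , h , refl | refl = i , h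

  descent-hook : ∀ {x y} → Descent π x y → ∃[ j ] (x , j) ∈ H
  descent-hook {x} {y} d = Equivalence.from (SW⇔top x) (y , d)

  descent-bottom : ∀ {x y} → Descent π x y → kind y ≡ X
  descent-bottom d with descent-hook d
  ... | _ , h = kind-role X h d

  descent-top : ∀ {x y} → Descent π x y → kind x ≡ Y
  descent-top d with descent-hook d
  ... | _ , h = kind-role Y h refl

  -- A descent top or NE endpoint x lying to the right of a higher point y would
  -- be the last letter of a 312 pattern formed with y and the point before x.
  increasing : ∀ {x y} → kind x ≢ X → val x Fin.< val y → x Fin.< y
  increasing {x} {y} x≢X vx<vy with Finₚ.<-cmp x y
  ... | tri< x<y _ _ = x<y
  ... | tri≈ _ refl _ = contradiction vx<vy (<-irrefl refl)
  ... | tri> _ _ y<x with predecessor y<x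
  ... | z , x≡1+z , y≤z with Finₚ.<-cmp (val z) (val x)
  ... | tri> _ _ vx<vz = contradiction (descent-bottom (x≡1+z , vx<vz)) x≢X
  ... | tri≈ _ vz≡vx _ with ⟨$⟩ʳ-injective π vz≡vx
  ... | refl = contradiction (sym x≡1+z) 1+n≢n
  increasing {x} {y} x≢X vx<vy | tri> _ _ y<x | z , x≡1+z , y≤z | tri< vz<vx _ _
    with m≤n⇒m<n∨m≡n y≤z
  ... | inj₁ y<z = contradiction (y , z , x , y<z , ≤-reflexive (sym x≡1+z) , vz<vx , vx<vy) av
  ... | inj₂ y≡z with toℕ-injective y≡z
  ... | refl = contradiction vx<vy (<-asym vz<vx)

  label : Fin n → Letter
  label v = kind (pos v)

  pos-increasing : ∀ {u v} → label u ≢ X → u Fin.< v → pos u Fin.< pos v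
  pos-increasing {u} {v} u≢X u<v = increasing u≢X
    (subst₂ Fin._<_ (sym (val-pos u)) (sym (val-pos v)) u<v)

  Bottom : Fin n → Fin n → Set
  Bottom b t = Descent π (pos t) (pos b)

  Hook : Fin n → Fin n → Set
  Hook t s = (pos t , pos s) ∈ H

  pos-val⁻ : ∀ {x} (P : Fin n → Set) → P x → P (pos (val x))
  pos-val⁻ P = subst P (sym (inverseˡ π))

  hook-opener : ∀ {x y} → (x , y) ∈ H → kind x ≡ Y
  hook-opener h = kind-role Y h refl

  hook-closer : ∀ {x y} → (x , y) ∈ H → kind y ≡ Z
  hook-closer h = kind-role Z h refl

  kind-≢ : ∀ {x a b} → a ≢ b → kind x ≡ a → kind x ≢ b
  kind-≢ a≢b x≡a x≡b = a≢b (trans (sym x≡a) x≡b)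

  bottom-order : ∀ {b t} → Bottom b t → b Fin.< t
  bottom-order {b} {t} (_ , vb<vt) = subst₂ Fin._<_ (val-pos b) (val-pos t) vb<vt

  bottomMatching : Matching label X Y Bottom
  bottomMatching = record
    { opener = descent-bottom
    ; closer = descent-top
    ; openTotal = openTotal
    ; closeTotal = closeTotal
    ; order = bottom-order
    ; functional = λ (eq , _) (eq′ , _) →
        pos-injective (toℕ-injective (suc-injective (trans (sym eq) eq′)))
    ; injective = λ (eq , _) (eq′ , _) →
        pos-injective (toℕ-injective (trans eq (sym eq′)))
    ; noncrossing = noncrossing
    }
    where
    openTotal : ∀ b → label b ≡ X → ∃[ t ] Bottom b t
    openTotal b b≡X with X-descent b≡X
    ... | i , _ , _ , d = val i , pos-val⁻ (λ x → Descent π x (pos b)) d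

    closeTotal : ∀ t → label t ≡ Y → ∃[ b ] Bottom b t
    closeTotal t t≡Y with Y-hook t≡Y
    ... | j , h with Equivalence.to (SW⇔top (pos t)) (j , h)
    ... | y , d = val y , pos-val⁻ (Descent π (pos t)) d

    noncrossing : ∀ {b t b′ t′} → Bottom b t → Bottom b′ t′ →
      b Fin.< b′ → b′ Fin.< t → t Fin.< t′ → ⊥
    noncrossing {b} {t} {b′} {t′} d@(pb≡1+pt , _) d′@(pb′≡1+pt′ , _) b<b′ b′<t t<t′ =
      -- A crossing is a 312 pattern with values t, b, b′: the bottom b stands right after t, and b′
      -- comes later because the tops t and t′ increase from left to right.
      av (pos t , pos b , pos b′ , ≤-reflexive (sym pb≡1+pt) , pb<pb′ ,
          subst₂ Fin._<_ (sym (val-pos b)) (sym (val-pos b′)) b<b′ ,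
          subst₂ Fin._<_ (sym (val-pos b′)) (sym (val-pos t)) b′<t)
      where
      pb<pb′ : pos b Fin.< pos b′
      pb<pb′ = subst₂ _<_ (sym pb≡1+pt) (sym pb′≡1+pt′)
        (s≤s (pos-increasing (kind-≢ (λ ()) (descent-top d)) t<t′))

  -- Two hooks with a common SW or NE endpoint would give that point two roles, whence functionality
  -- and injectivity.
  hookMatching : Matching label Y Z Hook
  hookMatching = record
    { opener = hook-opener
    ; closer = hook-closer
    ; openTotal = openTotal
    ; closeTotal = closeTotal
    ; order = λ {t} {s} h →
        subst₂ Fin._<_ (val-pos t) (val-pos s) (proj₂ (areHooks _ _ h))
    ; functional = λ h h′ → pos-injective
        (cong (proj₂ ∘ proj₁) (role-unique vhc red tight {s = _ , Y} {_ , Y} h refl h′ refl))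
    ; injective = λ h h′ → pos-injective
        (cong (proj₁ ∘ proj₁) (role-unique vhc red tight {s = _ , Z} {_ , Z} h refl h′ refl))
    ; noncrossing = noncrossing
    }
    where
    openTotal : ∀ t → label t ≡ Y → ∃[ s ] Hook t s
    openTotal t t≡Y with Y-hook t≡Y
    ... | j , h = val j , pos-val⁻ (λ y → (pos t , y) ∈ H) h

    closeTotal : ∀ s → label s ≡ Z → ∃[ t ] Hook t s
    closeTotal s s≡Z with Z-hook s≡Z
    ... | i , h = val i , pos-val⁻ (λ x → (x , pos s) ∈ H) h

    -- The horizontal segment of the first hook would meet the vertical one of the second.
    noncrossing : ∀ {t s t′ s′} → Hook t s → Hook t′ s′ →
      t Fin.< t′ → t′ Fin.< s → s Fin.< s′ → ⊥
    noncrossing {t} {s} {t′} {s′} h h′ t<t′ t′<s s<s′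
      with disjoint (pos t) (pos s) (pos t′) (pos s′) h h′
        (λ eq → <-irrefl (cong (toℕ ∘ proj₁) eq) pt<pt′)
        (coord (pos t′) , coord (val (pos s)))
        (inj₂ (refl , coord-mono (<⇒≤ pt<pt′) , coord-mono (<⇒≤ pt′<ps)))
        (inj₁ (refl , coord-mono (<⇒≤ vt′<vs) , coord-mono (<⇒≤ vs<vs′)))
      where
      pt<pt′ : pos t Fin.< pos t′
      pt<pt′ = pos-increasing (kind-≢ (λ ()) (hook-opener h)) t<t′
      pt′<ps : pos t′ Fin.< pos s
      pt′<ps = pos-increasing (kind-≢ (λ ()) (hook-opener h′)) t′<s
      vt′<vs : val (pos t′) Fin.< val (pos s)
      vt′<vs = subst₂ Fin._<_ (sym (val-pos t′)) (sym (val-pos s)) t′<s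
      vs<vs′ : val (pos s) Fin.< val (pos s′)
      vs<vs′ = subst₂ Fin._<_ (sym (val-pos s)) (sym (val-pos s′)) s<s′
    ... | inj₁ (eq , _) = <-irrefl
      (cong toℕ (pos-injective (coord-injective (cong proj₁ eq)))) t′<s
    ... | inj₂ (eq , _) = <-irrefl
      (cong toℕ (sym (pos-injective (coord-injective (cong proj₁ eq))))) t<t′

-- The left-to-right order in terms of labels.

module _ {n : ℕ} (lab : Fin n → Letter) (R : Fin n → Fin n → Set) where

  -- A descent bottom is placed with its descent top, any other point with itself.
  data Anchor : Fin n → Fin n → Set where
    self   : ∀ {v} → lab v ≢ X → Anchor v v
    bottom : ∀ {b t} → R b t → Anchor b t

  -- Left-to-right order of the points of values `u` and `v`, with no mention of positions, so that
  -- it can be carried to another configuration with the same labels. Points sharing an anchor are a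
  -- descent top and its bottom, in this order.
  data Before : Fin n → Fin n → Set where
    apart    : ∀ {u v s t} → Anchor u s → Anchor v t → s Fin.< t → Before u v
    adjacent : ∀ {b t} → R b t → Before t b

before-map : ∀ {n} {lab lab′ : Fin n → Letter} {R R′ : Fin n → Fin n → Set} →
  (∀ v → lab v ≡ lab′ v) → (∀ {b t} → R b t → R′ b t) →
  ∀ {u v} → Before lab R u v → Before lab′ R′ u v
before-map {lab = lab} {lab′} {R} {R′} lab≗ R⇒R′ = go
  where
  anchor : ∀ {v t} → Anchor lab R v t → Anchor lab′ R′ v t
  anchor (self v≢X)  = self (v≢X ∘ trans (lab≗ _))
  anchor (bottom r)  = bottom (R⇒R′ r)
  go : ∀ {u v} → Before lab R u v → Before lab′ R′ u v
  go (apart a a′ s<t) = apart (anchor a) (anchor a′) s<t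
  go (adjacent r)     = adjacent (R⇒R′ r)

module _ {n : ℕ} {π : Permutation′ n} {H : HookSet n}
  (av : Av312 n π) (vhc : IsVHC π H) (red : IsReduced π H)
  (tight : length (hookList H) * 3 ≤ n) where
  open Labelling av vhc red tight

  anchor-exists : ∀ v → ∃[ t ] Anchor label Bottom v t
  anchor-exists v with label v ≟ X
  ... | no v≢X  = v , self v≢X
  ... | yes v≡X with Matching.openTotal bottomMatching v v≡X
  ... | t , r = t , bottom r

  before⇒< : ∀ {u v} → Before label Bottom u v → pos u Fin.< pos v
  before⇒< (adjacent (eq , _)) = ≤-reflexive (sym eq)
  before⇒< (apart (self u≢X) (self v≢X) u<v) = pos-increasing u≢X u<v
  before⇒< (apart (self u≢X) (bottom (eq , _)) u<t) =
    subst (_ <_) (sym eq) (m<n⇒m<1+n (pos-increasing u≢X u<t))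
  before⇒< (apart (bottom d@(eq , _)) (bottom (eq′ , _)) s<t) =
    subst₂ _<_ (sym eq) (sym eq′) (s≤s (pos-increasing (kind-≢ (λ ()) (descent-top d)) s<t))
  before⇒< {u} {v} (apart (bottom d@(eq , _)) (self v≢X) s<v)
    with m≤n⇒m<n∨m≡n (pos-increasing (kind-≢ (λ ()) (descent-top d)) s<v)
  ... | inj₁ 1+ps<pv = subst (_< _) (sym eq) 1+ps<pv
  -- The place right after the top is occupied by its own bottom, which has label X.
  ... | inj₂ 1+ps≡pv = contradiction
    (subst (λ x → kind x ≡ X) (toℕ-injective (trans eq 1+ps≡pv)) (descent-bottom d)) v≢X

  -- Anchors are comparable, so one of the two orders holds; the wrong one is refuted by `before⇒<`.
  <⇒before : ∀ {u v} → pos u Fin.< pos v → Before label Bottom u v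
  <⇒before {u} {v} pu<pv with anchor-exists u | anchor-exists v
  ... | s , a | t , a′ with Finₚ.<-cmp s t
  ... | tri< s<t _ _ = apart a a′ s<t
  ... | tri> _ _ t<s = contradiction pu<pv (<-asym (before⇒< (apart a′ a t<s)))
  <⇒before pu<pv | _ , self _ | _ , self _ | tri≈ _ refl _ =
    contradiction pu<pv (<-irrefl refl)
  <⇒before pu<pv | _ , self _ | _ , bottom d | tri≈ _ refl _ = adjacent d
  <⇒before pu<pv | _ , bottom d | _ , self _ | tri≈ _ refl _ =
    contradiction pu<pv (<-asym (before⇒< (adjacent d)))
  <⇒before pu<pv | _ , bottom (eq , _) | _ , bottom (eq′ , _) | tri≈ _ refl _ =
    contradiction pu<pv (<-irrefl (trans eq (sym eq′)))

-- The word of a configuration determines it.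

take-length-++ : ∀ (u v : List Letter) → take (length u) (u ++ v) ≡ u
take-length-++ []      v = refl
take-length-++ (a ∷ u) v = cong (a ∷_) (take-length-++ u v)

take-all : ∀ (w : List Letter) {n} → length w ≡ n → take n w ≡ w
take-all []      refl = refl
take-all (a ∷ w) refl = cong (a ∷_) (take-all w refl)

tabulate-injective : ∀ {A : Set} {n} {f g : Fin n → A} →
  tabulate f ≡ tabulate g → ∀ i → f i ≡ g i
tabulate-injective eq Fin.zero    = proj₁ (∷-injective eq)
tabulate-injective eq (Fin.suc i) = tabulate-injective (proj₂ (∷-injective eq)) i

mono⇒inflationary : ∀ {n} (f : Fin n → Fin n) →
  (∀ {x y} → x Fin.< y → f x Fin.< f y) → ∀ x → toℕ x ≤ toℕ (f x)
mono⇒inflationary {n} f mono x = go (toℕ x) x refl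
  where
  go : ∀ m x → toℕ x ≡ m → m ≤ toℕ (f x)
  go zero    x _   = z≤n
  go (suc m) x x≡1+m = ≤-<-trans (go m (fromℕ< m<n) (toℕ-fromℕ< m<n))
    (mono (subst₂ _<_ (sym (toℕ-fromℕ< m<n)) (sym x≡1+m) ≤-refl))
    where
    m<n : m < n
    m<n = <-trans (≤-reflexive (sym x≡1+m)) (toℕ<n x)

tight : ∀ {k n} → n ≡ 3 * k → (C : RedVHC k (Av312 n)) →
  length (hookList (RedVHC.hooks C)) * 3 ≤ n
tight {k} refl C = ≤-reflexive (trans
  (cong (_* 3) (trans (length-hookList (RedVHC.hooks C)) (RedVHC.count C))) (*-comm k 3))

module LabellingOf {k n : ℕ} (n≡3k : n ≡ 3 * k) (C : RedVHC k (Av312 n)) =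
  Labelling (RedVHC.perm∈S C) (RedVHC.isVHC C) (RedVHC.reduced C) (tight n≡3k C)

module _ {k n : ℕ} (n≡3k : n ≡ 3 * k) where

  toDyck : RedVHC k (Av312 n) → Dyck³ k
  toDyck C = record
    { word     = word
    ; length≡  = trans length-word n≡3k
    ; #X       = #X
    ; #Y       = trans (sym #X≡#Y) #X
    ; #Z       = trans (sym (trans #X≡#Y #Y≡#Z)) #X
    ; prefixes = λ u v eq →
        subst (λ u → #[ Y ] u ≤ #[ X ] u × #[ Z ] u ≤ #[ Y ] u)
          (trans (cong (take (length u)) eq) (take-length-++ u v))
          (closers≤openers bottomMatching (length u) , closers≤openers hookMatching (length u))
    }
    where
    open LabellingOf n≡3k C
    word : List Letter
    word = tabulate label
    length-word : length word ≡ n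
    length-word = length-tabulate label
    balanced : ∀ {o c R} → Matching label o c R → #[ o ] word ≡ #[ c ] word
    balanced {o} {c} M = ≤-antisym (openers≤closers M)
      (subst (λ w → #[ c ] w ≤ #[ o ] w) (take-all word length-word) (closers≤openers M n))
    #X≡#Y : #[ X ] word ≡ #[ Y ] word
    #X≡#Y = balanced bottomMatching
    #Y≡#Z : #[ Y ] word ≡ #[ Z ] word
    #Y≡#Z = balanced hookMatching
    #X : #[ X ] word ≡ k
    -- The three letters are equally frequent and there are 3k of them in all.
    #X = *-cancelˡ-≡ _ _ 3 (begin
      3 * #[ X ] word                            ≡⟨ cong (#[ X ] word +_) (cong (#[ X ] word +_) (+-identityʳ _)) ⟩
      #[ X ] word + (#[ X ] word + #[ X ] word)  ≡⟨ +-assoc (#[ X ] word) _ _ ⟨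
      #[ X ] word + #[ X ] word + #[ X ] word
        ≡⟨ cong₂ _+_ (cong (#[ X ] word +_) #X≡#Y) (trans #X≡#Y #Y≡#Z) ⟩
      #[ X ] word + #[ Y ] word + #[ Z ] word    ≡⟨ #-total word ⟩
      length word                                ≡⟨ length-word ⟩
      n                                          ≡⟨ n≡3k ⟩
      3 * k                                      ∎)
      where open ≡-Reasoning

  module _ (C D : RedVHC k (Av312 n)) where
    private
      module C = LabellingOf n≡3k C
      module D = LabellingOf n≡3k D

    -- Equal data may come with proofs selecting different roles; a role in `C` is also a role in
    -- `D`, where its letter is forced.
    label-cong : RedVHC.perm C ≈ RedVHC.perm D → RedVHC.hooks C ≡ RedVHC.hooks D →
      ∀ v → C.label v ≡ D.label v
    label-cong π≈ refl v with role-exists (RedVHC.isVHC C) (RedVHC.reduced C) (C.pos v)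
    ... | ((i , j) , a) , h , r = sym (D.kind-role a h (role a r))
      where
      pos≡ : C.pos v ≡ D.pos v
      pos≡ = ⟨$⟩ʳ-injective (RedVHC.perm D) (trans (sym (π≈ (C.pos v)))
        (trans (C.val-pos v) (sym (D.val-pos v))))
      role : ∀ a → Role (RedVHC.perm C) (C.pos v) ((i , j) , a) →
        Role (RedVHC.perm D) (D.pos v) ((i , j) , a)
      role X (eq , desc) = trans (cong toℕ (sym pos≡)) eq ,
        subst₂ Fin._<_ (trans (π≈ _) (cong D.val pos≡)) (π≈ i) desc
      role Y eq = trans (sym pos≡) eq
      role Z eq = trans (sym pos≡) eq

    -- Sending a point of `C` to the point of `D` with the same value preserves the left-to-right
    -- order: `Before` depends only on the labels and the bottom matching, and the latter is unique.
    relocate-≥ : (∀ v → C.label v ≡ D.label v) → ∀ x → toℕ x ≤ toℕ (D.pos (C.val x))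
    relocate-≥ label≗ = mono⇒inflationary (D.pos ∘ C.val) λ x<y →
      before⇒< (RedVHC.perm∈S D) (RedVHC.isVHC D) (RedVHC.reduced D) (tight n≡3k D)
        (before-map label≗
          (matching-unique (matching-cong label≗ C.bottomMatching) D.bottomMatching)
          (<⇒before (RedVHC.perm∈S C) (RedVHC.isVHC C) (RedVHC.reduced C) (tight n≡3k C)
            (subst₂ Fin._<_ (sym (inverseˡ (RedVHC.perm C))) (sym (inverseˡ (RedVHC.perm C))) x<y)))

  module _ (C D : RedVHC k (Av312 n)) where
    private
      module C = LabellingOf n≡3k C
      module D = LabellingOf n≡3k D

    -- The relocation and its inverse both move no position to the left, so they are the identity.
    label⇒perm : (∀ v → C.label v ≡ D.label v) → RedVHC.perm C ≈ RedVHC.perm D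
    label⇒perm label≗ x = trans (sym (D.val-pos (C.val x))) (cong D.val (toℕ-injective
      (≤-antisym
        (subst (toℕ (D.pos (C.val x)) ≤_)
          (cong toℕ (trans (cong C.pos (D.val-pos (C.val x))) (inverseˡ (RedVHC.perm C))))
          (relocate-≥ D C (sym ∘ label≗) (D.pos (C.val x))))
        (relocate-≥ C D label≗ x))))

    label⇒hooks-⊆ : (∀ v → C.label v ≡ D.label v) → ∀ {x y} →
      (x , y) ∈ RedVHC.hooks C → (x , y) ∈ RedVHC.hooks D
    label⇒hooks-⊆ label≗ {x} {y} h = subst₂ (λ x y → (x , y) ∈ RedVHC.hooks D) (back x) (back y)
      (matching-unique (matching-cong label≗ C.hookMatching) D.hookMatching
        (subst₂ (λ x y → (x , y) ∈ RedVHC.hooks C)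
          (sym (inverseˡ (RedVHC.perm C))) (sym (inverseˡ (RedVHC.perm C))) h))
      where
      back : ∀ x → D.pos (C.val x) ≡ x
      back x = trans (cong D.pos (label⇒perm label≗ x)) (inverseˡ (RedVHC.perm D))

  toDyck-cong : ∀ {C D} → Setoid._≈_ (RedVHC-setoid k (Av312 n)) C D →
    Dyck³.word (toDyck C) ≡ Dyck³.word (toDyck D)
  toDyck-cong {C} {D} (π≈ , H≡) = tabulate-cong (label-cong C D π≈ H≡)

  toDyck-injective : ∀ {C D} → Dyck³.word (toDyck C) ≡ Dyck³.word (toDyck D) →
    Setoid._≈_ (RedVHC-setoid k (Av312 n)) C D
  toDyck-injective {C} {D} eq = label⇒perm C D label≗ ,
    (begin
      RedVHC.hooks C                        ≡⟨ tabulate∘lookup (RedVHC.hooks C) ⟨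
      Vec.tabulate (Vec.lookup (RedVHC.hooks C)) ≡⟨ Vecₚ.tabulate-cong row ⟩
      Vec.tabulate (Vec.lookup (RedVHC.hooks D)) ≡⟨ tabulate∘lookup (RedVHC.hooks D) ⟩
      RedVHC.hooks D                        ∎)
    where
    open ≡-Reasoning
    label≗ = tabulate-injective eq
    row : ∀ i → Vec.lookup (RedVHC.hooks C) i ≡ Vec.lookup (RedVHC.hooks D) i
    row i = ⊆-antisym (label⇒hooks-⊆ C D label≗) (label⇒hooks-⊆ D C (sym ∘ label≗))

-- Positions read off a word.

injective⇒surjective : ∀ {n} (f : Fin n → Fin n) →
  (∀ {x y} → f x ≡ f y → x ≡ y) → ∀ y → ∃[ x ] f x ≡ y
injective⇒surjective {suc n} f inj y with Finₚ.any? (λ x → f x Finₚ.≟ y)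
... | yes found  = found
... | no missing = ⊥-elim (Finₚ.<⇒notInjective {f = λ x → Fin.punchOut (y≢f x)} (n<1+n n)
  λ {x} {x′} eq → inj (Finₚ.punchOut-injective (y≢f x) (y≢f x′) eq))
  where
  y≢f : ∀ x → y ≢ f x
  y≢f x y≡fx = missing (x , sym y≡fx)

-- An X emits nothing, as its position is settled only by its Y, which then emits two points.
emitted : Letter → ℕ
emitted X = 0
emitted Y = 2
emitted Z = 1

-- The descent tops and NE endpoints increase from left to right, and a descent
-- top brings its descent bottom along: those of value < t fill outputs f t positions.
outputs : (ℕ → Letter) → ℕ → ℕ
outputs f zero    = 0
outputs f (suc t) = emitted (f t) + outputs f t

outputs-mono : ∀ f {s t} → s ≤ t → outputs f s ≤ outputs f t
outputs-mono f {s} {zero}  z≤n = z≤n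
outputs-mono f {s} {suc t} s≤1+t with m≤n⇒m<n∨m≡n s≤1+t
... | inj₁ s<1+t = ≤-trans (outputs-mono f (s≤s⁻¹ s<1+t)) (m≤n+m _ (emitted (f t)))
... | inj₂ refl  = ≤-refl

-- Each X holds back one output and each Y adds one in excess; at the end these cancel, so exactly n
-- positions are filled.
outputs+X≡t+Y : ∀ f t → outputs f t + occurrences X f t ≡ t + occurrences Y f t
outputs+X≡t+Y f zero    = refl
outputs+X≡t+Y f (suc t) with f t | outputs+X≡t+Y f t
... | X | eq = trans (+-suc (outputs f t) _) (cong suc eq)
... | Y | eq = cong suc (trans (cong suc eq) (sym (+-suc t _)))
... | Z | eq = cong suc eq

module Layout {n : ℕ} {lab : Fin n → Letter} {f : ℕ → Letter}
  (f≗lab : ∀ i → f (toℕ i) ≡ lab i) {B : Fin n → Fin n → Set}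
  (bottoms : Matching lab X Y B) (outputs-n : outputs f n ≡ n) where

  private
    module B = Matching bottoms

  -- At v t p : the point of value v, anchored at the value t, has position p.
  data At : Fin n → Fin n → ℕ → Set where
    self   : ∀ {v} → lab v ≢ X → At v v (outputs f (toℕ v))
    bottom : ∀ {b t} → B b t → At b t (suc (outputs f (toℕ t)))

  at-exists : ∀ v → ∃[ t ] ∃[ p ] At v t p
  at-exists v with lab v ≟ X
  ... | no v≢X  = v , _ , self v≢X
  ... | yes v≡X with B.openTotal v v≡X
  ... | t , r = t , _ , bottom r

  outputs-suc : ∀ {v a} → lab v ≡ a → outputs f (suc (toℕ v)) ≡ emitted a + outputs f (toℕ v)
  outputs-suc {v} v≡a = cong (λ b → emitted b + outputs f (toℕ v)) (trans (f≗lab v) v≡a)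

  at-lower : ∀ {v t p} → At v t p → outputs f (toℕ t) ≤ p
  at-lower (self _)   = ≤-refl
  at-lower (bottom _) = n≤1+n _

  at-upper : ∀ {v t p} → At v t p → p < outputs f (suc (toℕ t))
  at-upper (self {v} v≢X) with lab v in v≡
  ... | X = contradiction refl v≢X
  ... | Y = subst (outputs f (toℕ v) <_) (sym (outputs-suc v≡)) (n≤1+n _)
  ... | Z = subst (outputs f (toℕ v) <_) (sym (outputs-suc v≡)) ≤-refl
  at-upper (bottom {t = t} r) =
    subst (suc (outputs f (toℕ t)) <_) (sym (outputs-suc (B.closer r))) ≤-refl

  -- An anchor t owns the positions from `outputs f t` up to, but excluding, `outputs f (suc t)`;
  -- these blocks follow one another in the order of the anchors.
  at-< : ∀ {u s p v t q} → At u s p → At v t q → s Fin.< t → p < q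
  at-< a a′ s<t = ≤-trans (at-upper a) (≤-trans (outputs-mono f s<t) (at-lower a′))

  at-≤ : ∀ {u s p v t q} → At u s p → At v t q → p ≤ q → s Fin.≤ t
  at-≤ a a′ p≤q = ≮⇒≥ (λ t<s → <⇒≱ (at-< a′ a t<s) p≤q)

  -- A common position means a common block, in which the anchor stands first and its bottom second.
  at-injective : ∀ {u s v t p} → At u s p → At v t p → u ≡ v
  at-injective a a′ = same a a′ (toℕ-injective (≤-antisym (at-≤ a a′ ≤-refl) (at-≤ a′ a ≤-refl))) refl
    where
    same : ∀ {u s p v t q} → At u s p → At v t q → s ≡ t → p ≡ q → u ≡ v
    same (self _)   (self _)    refl _  = refl
    same (self _)   (bottom _)  refl eq = contradiction (sym eq) 1+n≢n
    same (bottom _) (self _)    refl eq = contradiction eq 1+n≢n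
    same (bottom r) (bottom r′) refl _  = B.injective r r′

  at-functional : ∀ {v s p t q} → At v s p → At v t q → s ≡ t × p ≡ q
  at-functional (self _)     (self _)    = refl , refl
  at-functional (self v≢X)   (bottom r)  = contradiction (B.opener r) v≢X
  at-functional (bottom r)   (self v≢X)  = contradiction (B.opener r) v≢X
  at-functional (bottom r)   (bottom r′) with B.functional r r′
  ... | refl = refl , refl

  value≤anchor : ∀ {v t p} → At v t p → v Fin.≤ t
  value≤anchor (self _)   = ≤-refl
  value≤anchor (bottom r) = <⇒≤ (B.order r)

  at-<n : ∀ {v t p} → At v t p → p < n
  at-<n {t = t} a = ≤-trans (at-upper a)
    (≤-trans (outputs-mono f (toℕ<n t)) (≤-reflexive outputs-n))

  -- Placing values at positions is an injective self-map of `Fin n`, hence invertible without a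
  -- formula for the inverse.
  arrangement : ∃ λ (π : Permutation′ n) → ∀ x → ∃[ t ] At (π ⟨$⟩ʳ x) t (toℕ x)
  arrangement = permutation val pos val-pos pos-val , located
    where
    pos : Fin n → Fin n
    pos v = fromℕ< (at-<n (proj₂ (proj₂ (at-exists v))))

    at-pos : ∀ v → ∃[ t ] At v t (toℕ (pos v))
    at-pos v = _ , subst (At v _) (sym (toℕ-fromℕ< (at-<n a))) a
      where a = proj₂ (proj₂ (at-exists v))

    pos-injective : ∀ {u v} → pos u ≡ pos v → u ≡ v
    pos-injective {u} {v} eq = at-injective (proj₂ (at-pos u))
      (subst (λ x → At v (proj₁ (at-pos v)) (toℕ x)) (sym eq) (proj₂ (at-pos v)))

    val : Fin n → Fin n
    val x = proj₁ (injective⇒surjective pos pos-injective x)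

    pos-val : ∀ x → pos (val x) ≡ x
    pos-val x = proj₂ (injective⇒surjective pos pos-injective x)

    val-pos : ∀ v → val (pos v) ≡ v
    val-pos v = pos-injective (pos-val (pos v))

    located : ∀ x → ∃[ t ] At (val x) t (toℕ x)
    located x = proj₁ (at-pos (val x)) ,
      subst (λ y → At (val x) (proj₁ (at-pos (val x))) (toℕ y)) (pos-val x)
        (proj₂ (at-pos (val x)))

-- The configuration built from two matchings.

module Arrangement {n : ℕ} {lab : Fin n → Letter} {f : ℕ → Letter}
  (f≗lab : ∀ i → f (toℕ i) ≡ lab i) {B K : Fin n → Fin n → Set}
  (bottoms : Matching lab X Y B) (mates : Matching lab Y Z K)
  (outputs-n : outputs f n ≡ n) (π : Permutation′ n)
  (located : ∀ x → ∃[ t ] Layout.At f≗lab bottoms outputs-n (π ⟨$⟩ʳ x) t (toℕ x)) where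

  open Layout f≗lab bottoms outputs-n
  private
    module B = Matching bottoms
    module K = Matching mates

  pos : Fin n → Fin n
  pos v = π ⟨$⟩ˡ v

  val : Fin n → Fin n
  val x = π ⟨$⟩ʳ x

  pos-val : ∀ x → pos (val x) ≡ x
  pos-val _ = inverseˡ π

  val-pos : ∀ v → val (pos v) ≡ v
  val-pos _ = inverseʳ π

  at⇒pos : ∀ {v t p} → At v t p → toℕ (pos v) ≡ p
  at⇒pos {v} a with located (pos v)
  ... | s , a′ = proj₂ (at-functional (subst (λ u → At u s (toℕ (pos v))) (val-pos v) a′) a)

  located-self : ∀ x → lab (val x) ≢ X → At (val x) (val x) (toℕ x)
  located-self x ≢X with located x
  ... | _ , a with at-functional a (self ≢X)
  ... | refl , _ = a

  -- Anchors weakly increase from left to right, and a value is at most its anchor. So in a 312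
  -- pattern the value at c lies below the anchor of b; then b and c are both descent bottoms and
  -- their pairs cross.
  avoids : Av312 n π
  avoids (a , b , c , a<b , b<c , vb<vc , vc<va)
    with located a | located b | located c
  ... | s , atA | t , atB | u , atC = crossing atB atC vb<vc
      (<-≤-trans vc<va (≤-trans (value≤anchor atA) (at-≤ atA atB (<⇒≤ a<b))))
      (at-≤ atB atC (<⇒≤ b<c))
    where
    crossing : ∀ {v s p w t q} → At v s p → At w t q → v Fin.< w → w Fin.< s → s Fin.≤ t → ⊥
    crossing (self _)   _          v<w w<s _ = <-asym v<w w<s
    crossing (bottom _) (self _)   v<w w<s s≤w = <⇒≱ w<s s≤w
    crossing (bottom r) (bottom r′) v<w w<s s≤t with m≤n⇒m<n∨m≡n s≤t
    ... | inj₁ s<t = B.noncrossing r r′ v<w w<s s<t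
    ... | inj₂ s≡t with toℕ-injective s≡t
    ... | refl = <-irrefl (cong toℕ (B.injective r r′)) v<w

  -- The decision is an argument so that membership can be proved for an arbitrary one.
  row : ∀ v → Dec (lab v ≡ Y) → Subset n
  row v (yes v≡Y) = ⁅ pos (proj₁ (K.openTotal v v≡Y)) ⁆
  row v (no _)    = ∅

  H : HookSet n
  H = Vec.tabulate λ x → row (val x) (lab (val x) ≟ Y)

  lookup-H : ∀ x → Vec.lookup H x ≡ row (val x) (lab (val x) ≟ Y)
  lookup-H x = lookup∘tabulate (λ x → row (val x) (lab (val x) ≟ Y)) x

  ∈H⇒K : ∀ {x y} → (x , y) ∈ H → K (val x) (val y)
  ∈H⇒K {x} {y} h with lab (val x) ≟ Y | subst (y ∈ₛ_) (lookup-H x) h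
  ... | no _    | y∈∅ = contradiction y∈∅ ∉⊥
  ... | yes x≡Y | y∈ with x∈⁅y⁆⇒x≡y (pos (proj₁ (K.openTotal (val x) x≡Y))) y∈
  ... | refl = subst (K (val x)) (sym (val-pos _)) (proj₂ (K.openTotal (val x) x≡Y))

  K⇒∈H : ∀ {x y} → K (val x) (val y) → (x , y) ∈ H
  K⇒∈H {x} {y} r = subst (y ∈ₛ_) (sym (lookup-H x)) (∈row (lab (val x) ≟ Y))
    where
    ∈row : ∀ d → y ∈ₛ row (val x) d
    ∈row (no ≢Y)   = contradiction (K.opener r) ≢Y
    ∈row (yes ≡Y) = subst (λ z → y ∈ₛ ⁅ z ⁆)
      (trans (sym (pos-val y)) (cong pos (K.functional r (proj₂ (K.openTotal (val x) ≡Y)))))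
      (x∈⁅x⁆ y)

  Y≢X : ∀ {v} → lab v ≡ Y → lab v ≢ X
  Y≢X v≡Y v≡X with trans (sym v≡Y) v≡X
  ... | ()

  Z≢X : ∀ {v} → lab v ≡ Z → lab v ≢ X
  Z≢X v≡Z v≡X with trans (sym v≡Z) v≡X
  ... | ()

  increasing : ∀ {x y} → lab (val x) ≢ X → lab (val y) ≢ X → val x Fin.< val y → x Fin.< y
  increasing {x} {y} x≢X y≢X = at-< (located-self x x≢X) (located-self y y≢X)

  increasing⁻ : ∀ {x y} → lab (val x) ≢ X → lab (val y) ≢ X → x Fin.≤ y → val x Fin.≤ val y
  increasing⁻ {x} {y} x≢X y≢X = at-≤ (located-self x x≢X) (located-self y y≢X)

  bottom-descent : ∀ {b x} → B b (val x) → Descent π x (pos b)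
  bottom-descent {b} {x} r =
    trans (at⇒pos (bottom r))
      (cong suc (proj₂ (at-functional (self (Y≢X (B.closer r))) (located-self x (Y≢X (B.closer r)))))) ,
    subst (Fin._< val x) (sym (val-pos b)) (B.order r)

  -- Any point other than a top is the last of its block, and `fresh` shows that the point right
  -- after a block is never lower: its anchor is larger, and a bottom is never first in its block.
  descent-top : ∀ {x y} → Descent π x y → lab (val x) ≡ Y
  descent-top {x} {y} (y≡1+x , vy<vx) with located x | located y
  ... | s , a | t , a′ = top a a′ y≡1+x vy<vx
    where
    fresh : ∀ {v s w t q} → At w t q → v Fin.≤ s → q ≡ outputs f (suc (toℕ s)) → w Fin.< v → ⊥
    fresh {s = s} {t = t} a′ v≤s q≡ w<v with Finₚ.<-cmp t s
    ... | tri< t<s _ _ = <⇒≱ (at-upper a′)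
      (subst (_ ≤_) (sym q≡) (outputs-mono f (m<n⇒m<1+n t<s)))
    ... | tri≈ _ refl _ = <-irrefl q≡ (at-upper a′)
    fresh (self _)   v≤s q≡ w<v | tri> _ _ s<w = <-asym w<v (≤-<-trans v≤s s<w)
    fresh (bottom r) v≤s q≡ w<v | tri> _ _ s<t =
      <⇒≱ (≤-reflexive q≡) (outputs-mono f s<t)
    top : ∀ {v s p w t q} → At v s p → At w t q → q ≡ suc p → w Fin.< v → lab v ≡ Y
    top (self {v} v≢X) a′ q≡ w<v with lab v in v≡
    ... | X = contradiction refl v≢X
    ... | Y = refl
    ... | Z = ⊥-elim (fresh {v} a′ ≤-refl (trans q≡ (sym (outputs-suc v≡))) w<v)
    top (bottom r) a′ q≡ w<v =
      ⊥-elim (fresh a′ (<⇒≤ (B.order r)) (trans q≡ (sym (outputs-suc (B.closer r)))) w<v)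

  descent-bottom : ∀ {x y} → Descent π x y → lab (val y) ≡ X
  descent-bottom {x} {y} d with B.closeTotal (val x) (descent-top d)
  ... | b , r with bottom-descent {b} {x} r
  ... | eq , _ with toℕ-injective {i = pos b} {y} (trans eq (sym (proj₁ d)))
  ... | refl = subst (λ v → lab v ≡ X) (sym (val-pos b)) (B.opener r)

  mate-of-top : ∀ {x} → lab (val x) ≡ Y → ∃[ y ] (x , y) ∈ H
  mate-of-top {x} x≡Y with K.openTotal (val x) x≡Y
  ... | s , r = pos s , K⇒∈H (subst (K (val x)) (sym (val-pos s)) r)

  -- A common point gives i′ ≤ i ≤ j′, with the height of j′ at most that of j. If i′ = i or the
  -- heights agree, the hooks coincide; i = j′ is excluded by the letters Y and Z; otherwise the
  -- pairs cross in `K`.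
  vertical-horizontal : ∀ {i j i′ j′} → (i , j) ∈ H → (i′ , j′) ∈ H → (i , j) ≢ (i′ , j′) →
    ∀ p → OnVertical π i j p → OnHorizontal π i′ j′ p → ⊥
  vertical-horizontal {i} {j} {i′} {j′} h h′ ≢h′ _ (refl , _ , y≤vj) (refl , i′≤x , x≤j′)
    with ∈H⇒K h | ∈H⇒K h′
  ... | r | r′ with m≤n⇒m<n∨m≡n {toℕ i′} {toℕ i} (coord-cancel-≤ {i = i′} {i} i′≤x)
                  | m≤n⇒m<n∨m≡n {toℕ (val j′)} {toℕ (val j)} (coord-cancel-≤ {i = val j′} {val j} y≤vj)
  ... | inj₂ i′≡i | _ with toℕ-injective i′≡i
  ... | refl with trans (sym (pos-val j)) (trans (cong pos (K.functional r r′)) (pos-val j′))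
  ... | refl = ≢h′ refl
  vertical-horizontal {i} {j} {i′} {j′} h h′ ≢h′ _ (refl , _ , y≤vj) (refl , i′≤x , x≤j′)
    | r | r′ | inj₁ i′<i | inj₂ vj′≡vj =
    <-irrefl (cong toℕ (trans (sym (pos-val i′)) (trans (cong pos (K.injective r′
      (subst (K (val i)) (sym (toℕ-injective vj′≡vj)) r))) (pos-val i)))) i′<i
  vertical-horizontal {i} {j} {i′} {j′} h h′ ≢h′ _ (refl , _ , y≤vj) (refl , i′≤x , x≤j′)
    | r | r′ | inj₁ i′<i | inj₁ vj′<vj =
    K.noncrossing r′ r
      (≤∧≢⇒< (increasing⁻ (Y≢X (K.opener r′)) (Y≢X (K.opener r)) (<⇒≤ i′<i))
        (λ eq → <-irrefl (cong toℕ (⟨$⟩ʳ-injective π (toℕ-injective eq))) i′<i))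
      (≤∧≢⇒< (increasing⁻ (Y≢X (K.opener r)) (Z≢X (K.closer r′)) (coord-cancel-≤ {i = i} {j′} x≤j′))
        (λ eq → Y≢Z (trans (sym (K.opener r)) (trans (cong lab (toℕ-injective eq)) (K.closer r′)))))
      vj′<vj
    where
    Y≢Z : Y ≢ Z
    Y≢Z ()

  isVHC : IsVHC π H
  isVHC = record
    { areHooks  = λ i j h → let r = ∈H⇒K {i} {j} h in
        increasing (Y≢X (K.opener r)) (Z≢X (K.closer r)) (K.order r) , K.order r
    ; SW⇔top    = λ x → mk⇔ (λ (_ , h) → has-bottom x (K.opener (∈H⇒K h)))
                             (λ (_ , d) → mate-of-top (descent-top d))
    -- The value at l is at most its anchor, hence at most the anchor of j, which is the value at j
    -- since j has letter Z.
    ; noneAbove = λ i j h (l , _ , l<j , vj<vl) → <⇒≱ vj<vl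
        (≤-trans (value≤anchor (proj₂ (located l)))
          (at-≤ (proj₂ (located l)) (located-self j (Z≢X (K.closer (∈H⇒K {i} {j} h)))) (<⇒≤ l<j)))
    -- Distinct hooks do not meet at all: even the permitted contact would give one point both
    -- letters Y and Z.
    ; disjoint  = λ i j i′ j′ h h′ ≢h′ p on on′ → ⊥-elim (meet h h′ ≢h′ p on on′)
    }
    where
    has-bottom : ∀ x → lab (val x) ≡ Y → DescentTop π x
    has-bottom x x≡Y with B.closeTotal (val x) x≡Y
    ... | b , r = pos b , bottom-descent r
    meet : ∀ {i j i′ j′} → (i , j) ∈ H → (i′ , j′) ∈ H → (i , j) ≢ (i′ , j′) →
      ∀ p → OnHook π i j p → OnHook π i′ j′ p → ⊥
    meet {i} {j} {i′} {j′} h h′ ≢h′ (x , y) (inj₁ (x≡i , _)) (inj₁ (x≡i′ , _))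
      with coord-injective {i = i} {i′} (trans (sym x≡i) x≡i′)
    ... | refl with trans (sym (pos-val j))
                      (trans (cong pos (K.functional (∈H⇒K h) (∈H⇒K h′))) (pos-val j′))
    ... | refl = ≢h′ refl
    meet {i} {j} {i′} {j′} h h′ ≢h′ (x , y) (inj₂ (y≡j , _)) (inj₂ (y≡j′ , _))
      with ⟨$⟩ʳ-injective π {j} {j′} (coord-injective (trans (sym y≡j) y≡j′))
    ... | refl with trans (sym (pos-val i))
                      (trans (cong pos (K.injective (∈H⇒K h) (∈H⇒K h′))) (pos-val i′))
    ... | refl = ≢h′ refl
    meet h h′ ≢h′ p (inj₁ v) (inj₂ hor) = vertical-horizontal h h′ ≢h′ p v hor
    meet h h′ ≢h′ p (inj₂ hor) (inj₁ v) = vertical-horizontal h′ h (≢h′ ∘ sym) p v hor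

  isReduced : IsReduced π H
  isReduced x with lab (val x) in x≡
  ... | Y = inj₁ (mate-of-top x≡)
  ... | Z with K.closeTotal (val x) x≡
  ... | t , r = inj₂ (inj₁ (pos t , K⇒∈H (subst (λ t → K t (val x)) (sym (val-pos t)) r)))
  isReduced x | X with B.openTotal (val x) x≡
  ... | t , r = inj₂ (inj₂ (pos t , subst (Descent π (pos t)) (pos-val x)
    (bottom-descent (subst (B (val x)) (sym (val-pos t)) r))))

  -- Holds for every role of `x`, so the word read off is `lab` whichever role the proofs select.
  role-letter : ∀ {x} s → proj₁ s ∈ H → Role π x s → lab (val x) ≡ proj₂ s
  role-letter (_ , X) h d    = descent-bottom d
  role-letter (_ , Y) h refl = K.opener (∈H⇒K h)
  role-letter (_ , Z) h refl = K.closer (∈H⇒K h)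

  -- A hook is determined by its SW endpoint, a Y-point.
  hooks≤Y : length (hookList H) ≤ #[ Y ] (tabulate lab)
  hooks≤Y = subst (length (hookList H) ≤_) (sym (#-tabulate Y lab))
    (pigeonhole-≤ (λ (x , y) v → K (val x) (val y) × val x ≡ v) (hookList-unique H) cover
      λ { {x , y} {x′ , y′} (r , refl) (r′ , eq) →
        same (⟨$⟩ʳ-injective π eq) r r′ })
    where
    cover : ∀ {h} → h ∈ˡ hookList H → ∃[ v ] (v ∈ˡ filter (λ i → Y ≟ lab i) (allFin n) ×
      K (val (proj₁ h)) (val (proj₂ h)) × val (proj₁ h) ≡ v)
    cover {x , y} h∈ = val x , ∈-filter⁺ (λ i → Y ≟ lab i) (∈-allFin (val x))
      (sym (K.opener r)) , r , refl
      where r = ∈H⇒K {x} {y} (∈-hookList⁻ H h∈)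
    same : ∀ {x y x′ y′} → x′ ≡ x → K (val x) (val y) → K (val x′) (val y′) → (x , y) ≡ (x′ , y′)
    same refl r r′ = cong (_ ,_) (⟨$⟩ʳ-injective π (K.functional r r′))

  toRedVHC : ∀ {k} → n ≡ 3 * k → #[ Y ] (tabulate lab) ≡ k → RedVHC k (Av312 n)
  toRedVHC {k} n≡3k #Y = record
    { perm    = π
    ; perm∈S  = avoids
    ; hooks   = H
    ; isVHC   = isVHC
    ; reduced = isReduced
    ; count   = trans (sym (length-hookList H)) (≤-antisym
        (subst (length (hookList H) ≤_) #Y hooks≤Y)
        (*-cancelˡ-≤ 3 (subst₂ _≤_ n≡3k (*-comm (length (hookList H)) 3) (n≤3*hooks isVHC isReduced))))
    }

  word-toRedVHC : ∀ {k} (n≡3k : n ≡ 3 * k) (#Y : #[ Y ] (tabulate lab) ≡ k) →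
    Dyck³.word (toDyck n≡3k (toRedVHC n≡3k #Y)) ≡ tabulate lab
  word-toRedVHC n≡3k #Y = tabulate-cong λ v → label≡lab v (role-exists isVHC isReduced (pos v))
    where
    label≡lab : ∀ v (e : ∃[ s ] (proj₁ s ∈ H × Role π (pos v) s)) → proj₂ (proj₁ e) ≡ lab v
    label≡lab v (s , h , r) = trans (sym (role-letter s h r)) (cong lab (val-pos v))

-- The bijection.

-- Matching the length equation with `refl` makes `n` the length of the word, so that `lookup` is
-- the labelling; the equation with `3 * k` stays propositional.
fromDyck : ∀ {k n} (d : Dyck³ k) → length (Dyck³.word d) ≡ n → (n≡3k : n ≡ 3 * k) →
  ∃ λ (C : RedVHC k (Av312 n)) → Dyck³.word (toDyck n≡3k C) ≡ Dyck³.word d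
fromDyck {k} d refl n≡3k = toRedVHC n≡3k #Y′ , trans (word-toRedVHC n≡3k #Y′) (tabulate-lookup w)
  where
  w = Dyck³.word d
  n = length w
  f = letterAt w

  occurs : ∀ a → occurrences a f n ≡ #[ a ] w
  occurs a = trans (sym (#-take a w n ≤-refl)) (cong #[ a ] (take-all w refl))

  ballot : ∀ t → t ≤ n → occurrences Y f t ≤ occurrences X f t × occurrences Z f t ≤ occurrences Y f t
  ballot t t≤n = subst₂ _≤_ (#-take Y w t t≤n) (#-take X w t t≤n) (proj₁ prefix) ,
                 subst₂ _≤_ (#-take Z w t t≤n) (#-take Y w t t≤n) (proj₂ prefix)
    where prefix = Dyck³.prefixes d (take t w) (drop t w) (sym (take++drop≡id t w))

  Y≡X : occurrences Y f n ≡ occurrences X f n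
  Y≡X = trans (trans (occurs Y) (Dyck³.#Y d)) (sym (trans (occurs X) (Dyck³.#X d)))

  Z≡Y : occurrences Z f n ≡ occurrences Y f n
  Z≡Y = trans (trans (occurs Z) (Dyck³.#Z d)) (sym (trans (occurs Y) (Dyck³.#Y d)))

  outputs-n : outputs f n ≡ n
  outputs-n = +-cancelʳ-≡ (occurrences Y f n) _ _
    (trans (cong (outputs f n +_) Y≡X) (outputs+X≡t+Y f n))

  #Y′ : #[ Y ] (tabulate (lookup w)) ≡ k
  #Y′ = trans (cong #[ Y ] (tabulate-lookup w)) (Dyck³.#Y d)

  bottoms = stack-matching (λ ()) (λ t t≤n → proj₁ (ballot t t≤n)) Y≡X (letterAt-lookup w)
  mates   = stack-matching (λ ()) (λ t t≤n → proj₂ (ballot t t≤n)) Z≡Y (letterAt-lookup w)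
  layout  = Layout.arrangement (letterAt-lookup w) bottoms outputs-n

  open Arrangement (letterAt-lookup w) bottoms mates outputs-n (proj₁ layout) (proj₂ layout)

theorem3p2 : (k : ℕ) → 1 ≤ k →
    Inverse (RedVHC-setoid k (Av312 (3 * k))) (Dyck³-setoid k)
theorem3p2 k _ = record
  { to        = toDyck refl
  ; from      = from
  ; to-cong   = λ {C} {D} → toDyck-cong refl {C} {D}
  -- The preimages also depend on the proofs inside `d` and `e`; injectivity identifies them because
  -- they have the same word.
  ; from-cong = λ {d} {e} d≈e → toDyck-injective refl {from d} {from e}
      (trans (to-from d) (trans d≈e (sym (to-from e))))
  ; inverse   =
      (λ {d} {C} C≈ → trans (toDyck-cong refl {C} {from d} C≈) (to-from d)) ,
      (λ {C} {d} d≈ → toDyck-injective refl {from d} {C} (trans (to-from d) d≈))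
  }
  where
  from : Dyck³ k → RedVHC k (Av312 (3 * k))
  from d = proj₁ (fromDyck d (Dyck³.length≡ d) refl)
  to-from : ∀ d → Dyck³.word (toDyck refl (from d)) ≡ Dyck³.word d
  to-from d = proj₂ (fromDyck d (Dyck³.length≡ d) refl)
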